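{- Let $\mathbf{d}=(d_1,\dots,d_n)$ be a graphical sequence. Then $\mathbf{d}$ admits a realization (a simple graph) containing two spanning trees that share at most one edge if and only if $\sum_{i=1}^n d_i\ge 4(n-1)-2$ and either (a) $n\le 2$, or (b) $n>2$, $d_{n-1}\ge 2$ and $d_n\ge 1$.
   Context: A degree sequence is non-increasing, $d_1\ge\dots\ge d_n\ge 0$; it is graphical if some simple graph on vertices $v_1,\dots,v_n$ has $\deg(v_i)=d_i$ (a realization). Two spanning trees share at most one edge if their edge sets have at most one common element. -}

module Defs where

open import Data.Nat using (ℕ; zero; suc; _≤_; _<_; _<?_; _∸_)
open import Data.Fin using (Fin; fromℕ<; toℕ)
open import Data.Bool using (Bool; true; false; if_then_else_)
open import Data.List using (List; []; _∷_; _++_; [_]; map; length; allFin)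
open import Data.Nat.ListAction using (sum)
open import Data.List.Relation.Unary.Unique.Propositional using (Unique)
open import Data.Product using (Σ; _×_; ∃-syntax)
open import Relation.Nullary using (¬_; yes; no)
open import Relation.Binary.PropositionalEquality using (_≡_)

record SimpleGraph (n : ℕ) : Set where
  field
    adj   : Fin n → Fin n → Bool
    sym   : ∀ i j → adj i j ≡ adj j i
    irrfl : ∀ i → adj i i ≡ false
open SimpleGraph public

degree : ∀ {n} → SimpleGraph n → Fin n → ℕ
degree {n} G i = sum (map (λ j → if adj G i j then 1 else 0) (allFin n))

NonIncreasing : ∀ {n} → (Fin n → ℕ) → Set
NonIncreasing {n} d = ∀ (i j : Fin n) → toℕ i ≤ toℕ j → d j ≤ d i

Realizes : ∀ {n} → SimpleGraph n → (Fin n → ℕ) → Set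
Realizes G d = ∀ i → degree G i ≡ d i

Graphical : ∀ {n} → (Fin n → ℕ) → Set
Graphical {n} d = NonIncreasing d × ∃[ G ] Realizes {n} G d

data Walk {n} (G : SimpleGraph n) : Fin n → Fin n → Set where
  here : ∀ {u} → Walk G u u
  step : ∀ {u v w} → adj G u v ≡ true → Walk G v w → Walk G u w

Connected : ∀ {n} → SimpleGraph n → Set
Connected G = ∀ u v → Walk G u v

Chain : ∀ {n} → SimpleGraph n → List (Fin n) → Set
Chain G []           = Data.Unit.⊤ where import Data.Unit
Chain G (x ∷ [])     = Data.Unit.⊤ where import Data.Unit
Chain G (x ∷ y ∷ vs) = (adj G x y ≡ true) × Chain G (y ∷ vs)

IsCycle : ∀ {n} → SimpleGraph n → Fin n → List (Fin n) → Set
IsCycle G v vs = (2 ≤ length vs) × Unique (v ∷ vs) × Chain G (v ∷ vs ++ [ v ])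

Acyclic : ∀ {n} → SimpleGraph n → Set
Acyclic G = ∀ v vs → ¬ IsCycle G v vs

IsTree : ∀ {n} → SimpleGraph n → Set
IsTree G = Connected G × Acyclic G

Subgraph : ∀ {n} → SimpleGraph n → SimpleGraph n → Set
Subgraph T G = ∀ i j → adj T i j ≡ true → adj G i j ≡ true

IsSpanningTree : ∀ {n} → SimpleGraph n → SimpleGraph n → Set
IsSpanningTree T G = Subgraph T G × IsTree T

-- the edge sets of T₁ and T₂ have at most one common element
-- (edges {i,j} represented with toℕ i < toℕ j)
ShareAtMostOneEdge : ∀ {n} → SimpleGraph n → SimpleGraph n → Set
ShareAtMostOneEdge {n} T₁ T₂ =
  ∀ (i j k l : Fin n) → toℕ i < toℕ j → toℕ k < toℕ l →
    adj T₁ i j ≡ true → adj T₂ i j ≡ true →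
    adj T₁ k l ≡ true → adj T₂ k l ≡ true →
    (i ≡ k) × (j ≡ l)

-- 1-based access d_k (k = 1..n); 0 out of range (never used out of range below)
at : ∀ {n} → (Fin n → ℕ) → ℕ → ℕ
at {n} d k with (k ∸ 1) <? n
... | yes p = d (fromℕ< p)
... | no _  = 0

sumSeq : ∀ {n} → (Fin n → ℕ) → ℕ
sumSeq {n} d = sum (map d (allFin n))

{-# OPTIONS --safe #-}
module Submission where

-- A connected graph contains a spanning tree, so it suffices to find a
-- realization with two connected spanning subgraphs C₁, C₂ sharing at most s
-- edges, s ∈ {0,1}.  If all degrees are at least 2 and the degree sum is at
-- least 4(n-1) - 2s this is done by induction on n, removing a vertex v of
-- minimum degree.
--   * deg v = 2: after 2-switches both neighbours of v have degree ≥ 3, so v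
--     may be deleted; afterwards one edge at v goes to C₁ and the other to C₂.
--   * deg v ≥ 4, or deg v = 3 and the degree sum has slack: the same works
--     without switching.
--   * deg v = 3, no slack: if neighbours a, b of v are not adjacent, delete v
--     and add ab.  In the realization obtained by induction some edge uw
--     avoiding the third neighbour c is missing from one of the C's; subdivide
--     uw by v and join v to c.  If the neighbourhood of v is a triangle, either
--     a 2-switch destroys one of its edges, or a discharging argument shows
--     that the graph is K₄.
-- A vertex of degree 1 has its edge in both subgraphs, which reduces this case
-- to s = 0.  Conversely, connectedness gives each tree n-1 edges, and two
-- vertices of degree 1 would give two shared edges.

open import Defs
open import Data.Nat using (ℕ; zero; suc; _+_; _≤_; _<_; z≤n; s≤s; _≤?_; _<?_) renaming (_*_ to _·_)
open import Data.Nat.Properties hiding (_≟_)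
open import Data.Nat.ListAction using () renaming (sum to sumᴸ)
open import Data.Nat.Tactic.RingSolver using (solve-∀)
open import Data.Fin using (Fin; zero; suc; toℕ; fromℕ<)
open import Data.Fin.Permutation using (Permutation; _⟨$⟩ʳ_; _⟨$⟩ˡ_; transpose; inverseˡ; inverseʳ; flip)
open import Data.Fin.Properties using (_≟_; any?; toℕ-injective; toℕ-fromℕ<; toℕ<n)
open import Data.Bool using (Bool; true; false; if_then_else_; _∧_; _∨_; not)
open import Data.Bool.Properties using (∨-comm; ∧-comm; ∧-zeroʳ) renaming (_≟_ to _≟ᵇ_)
open import Data.List using (List; []; _∷_; _++_; [_]; tabulate; map; allFin)
open import Data.List.Properties using (map-tabulate)
open import Data.List.Relation.Unary.All using (All; []; _∷_)
open import Data.List.Relation.Unary.AllPairs using (_∷_)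
open import Data.List.Relation.Unary.Unique.Propositional using (Unique)
open import Data.Product using (_×_; ∃-syntax; _,_; proj₁; proj₂; map₂)
open import Data.Sum using (_⊎_; inj₁; inj₂)
open import Data.Empty using (⊥; ⊥-elim)
open import Function using (_∘_; id)
open import Function.Bundles using (_⇔_; mk⇔)
open import Relation.Nullary using (¬_; ¬?; _×-dec_; Dec; yes; no; does; contradiction)
open import Relation.Nullary.Decidable using (dec-true; dec-false)
open import Relation.Binary using (Tri; tri<; tri≈; tri>)
open import Relation.Binary.PropositionalEquality as ≡ using (_≡_; _≢_; refl; trans; cong; cong₂; subst)
open import Algebra.Properties.CommutativeMonoid.Sum +-0-commutativeMonoid using (sum; sum-cong-≗; ∑-distrib-+; ∑-comm; sum-permute; sum-replicate-zero)

private variable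
  n m : ℕ

-- Boolean indicators

ι : Bool → ℕ
ι b = if b then 1 else 0

infix 5 _==_
_==_ : Fin n → Fin n → Bool
i == j = does (i ≟ j)

δ : Fin n → Fin n → ℕ
δ i j = ι (i == j)

==-refl : (i : Fin n) → (i == i) ≡ true
==-refl i with i ≟ i
... | yes _  = refl
... | no i≢i = contradiction refl i≢i

==-sound : {i j : Fin n} → (i == j) ≡ true → i ≡ j
==-sound {i = i} {j} e with i ≟ j
... | yes p = p

==-≢ : {i j : Fin n} → i ≢ j → (i == j) ≡ false
==-≢ {i = i} {j} i≢j with i ≟ j
... | yes p = contradiction p i≢j
... | no _  = refl

==-sym : (i j : Fin n) → (i == j) ≡ (j == i)
==-sym i j with i ≟ j | j ≟ i
... | yes _ | yes _ = refl
... | yes p | no q  = contradiction (≡.sym p) q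
... | no p  | yes q = contradiction (≡.sym q) p
... | no _  | no _  = refl

ι≤1 : ∀ b → ι b ≤ 1
ι≤1 true  = s≤s z≤n
ι≤1 false = z≤n

true≢false : {b : Bool} → b ≡ true → b ≡ false → ⊥
true≢false refl ()

∧-elimˡ : ∀ {a b} → a ∧ b ≡ true → a ≡ true
∧-elimˡ {true} _ = refl

∧-elimʳ : ∀ {a b} → a ∧ b ≡ true → b ≡ true
∧-elimʳ {true} p = p

∨-elim : ∀ {a b} → a ∨ b ≡ true → a ≡ true ⊎ b ≡ true
∨-elim {true}  _ = inj₁ refl
∨-elim {false} p = inj₂ p

∨-introˡ : ∀ {a b} → a ≡ true → a ∨ b ≡ true
∨-introˡ refl = refl

∨-introʳ : ∀ {a b} → b ≡ true → a ∨ b ≡ true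
∨-introʳ {true}  _ = refl
∨-introʳ {false} p = p

-- A hypothesis l ≤ r proves a ≤ b once a + r falls short of b + l by a
-- natural number k; the equation is then left to the ring solver.
≤-from : ∀ {l r} a b k → l ≤ r → a + r + k ≡ b + l → a ≤ b
≤-from {l} {r} a b k l≤r eq = +-cancelʳ-≤ r a b (≤-trans (m≤m+n (a + r) k) (≤-trans (≤-reflexive eq) (+-monoʳ-≤ b l≤r)))

absurd-from : ∀ {A : Set} {l r} k → l ≤ r → suc (r + k) ≡ l → A
absurd-from {r = r} k l≤r refl = contradiction (≤-trans (s≤s (m≤m+n r k)) l≤r) (<-irrefl refl)

-- Finite sums

sum-mono : {f g : Fin n → ℕ} → (∀ i → f i ≤ g i) → sum f ≤ sum g
sum-mono {zero}  f≤g = z≤n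
sum-mono {suc n} f≤g = +-mono-≤ (f≤g zero) (sum-mono (f≤g ∘ suc))

sum-zero : {f : Fin n → ℕ} → (∀ i → f i ≡ 0) → sum f ≡ 0
sum-zero {n} f≡0 = trans (sum-cong-≗ f≡0) (sum-replicate-zero n)

sum-const : ∀ n c → sum {n} (λ _ → c) ≡ n · c
sum-const zero    c = refl
sum-const (suc n) c = cong (c +_) (sum-const n c)

sum-·ˡ : ∀ c (f : Fin n → ℕ) → sum (λ i → c · f i) ≡ c · sum f
sum-·ˡ {zero}  c f = ≡.sym (*-zeroʳ c)
sum-·ˡ {suc n} c f = trans (cong (c · f zero +_) (sum-·ˡ c (f ∘ suc))) (≡.sym (*-distribˡ-+ c (f zero) _))

δ-suc : (i j : Fin n) → δ (suc i) (suc j) ≡ δ i j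
δ-suc i j with i ≟ j
... | yes _ = refl
... | no  _ = refl

sum-pick : (x : Fin n) (f : Fin n → ℕ) → sum (λ j → δ x j · f j) ≡ f x
sum-pick {suc n} zero f = trans (cong₂ _+_ (+-identityʳ (f zero)) (sum-zero {f = λ j → δ zero (suc j) · f (suc j)} (λ _ → refl))) (+-identityʳ (f zero))
sum-pick {suc n} (suc x) f = trans (sum-cong-≗ (λ j → cong (_· f (suc j)) (δ-suc x j))) (sum-pick x (f ∘ suc))

sum-δ : (x : Fin n) → sum (δ x) ≡ 1
sum-δ x = trans (sum-cong-≗ (λ j → ≡.sym (*-identityʳ (δ x j)))) (sum-pick x (λ _ → 1))

sum-≥ : (f : Fin n → ℕ) (x : Fin n) → f x ≤ sum f
sum-≥ f zero    = m≤m+n (f zero) _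
sum-≥ f (suc x) = ≤-trans (sum-≥ (f ∘ suc) x) (m≤n+m _ (f zero))

listSum≡sum : (f : Fin n → ℕ) → sumᴸ (map f (allFin n)) ≡ sum f
listSum≡sum {n} f = trans (cong sumᴸ (map-tabulate id f)) (go f)
  where
  go : ∀ {n} (f : Fin n → ℕ) → sumᴸ (tabulate f) ≡ sum f
  go {zero}  f = refl
  go {suc n} f = cong (f zero +_) (go (f ∘ suc))

-- Counting the elements of a Boolean set

pick : (f : Fin n → Bool) → 1 ≤ sum (ι ∘ f) → ∃[ x ] f x ≡ true
pick {suc n} f p with f zero in eq
... | true  = zero , eq
... | false with pick (f ∘ suc) p
...   | x , fx = suc x , fx

without : (Fin n → Bool) → Fin n → Fin n → Bool
without f x j = f j ∧ not (x == j)

ι-without : (x : Fin n) (f : Fin n → Bool) → f x ≡ true → ∀ j → ι (f j) ≡ δ x j + ι (without f x j)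
ι-without x f fx j with x ≟ j
... | yes refl rewrite fx = refl
... | no _ with f j
...   | true  = refl
...   | false = refl

sum-without : (f : Fin n → Bool) (x : Fin n) → f x ≡ true → sum (ι ∘ f) ≡ suc (sum (ι ∘ without f x))
sum-without f x fx = trans (sum-cong-≗ (ι-without x f fx)) (trans (∑-distrib-+ (δ x) _) (cong (_+ sum (ι ∘ without f x)) (sum-δ x)))

without-≢ : (f : Fin n → Bool) {x j : Fin n} → without f x j ≡ true → x ≢ j
without-≢ f {x} p refl with f x | ==-refl x
... | true  | e rewrite e with p
...   | ()

sum≡0 : (f : Fin n → ℕ) → sum f ≡ 0 → ∀ j → f j ≡ 0
sum≡0 f e j = n≤0⇒n≡0 (≤-trans (sum-≥ f j) (≤-reflexive e))

pick₂ : (f : Fin n → Bool) → 2 ≤ sum (ι ∘ f) → ∃[ x ] ∃[ y ] (f x ≡ true × f y ≡ true × x ≢ y)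
pick₂ f p with pick f (≤-trans (s≤s z≤n) p)
... | x , fx with pick (without f x) (≤-pred (≤-trans p (≤-reflexive (sum-without f x fx))))
...   | y , gy = x , y , fx , ∧-elimˡ gy , without-≢ f gy

enum₁ : (f : Fin n → Bool) → sum (ι ∘ f) ≡ 1 → ∃[ x ] (f x ≡ true × (∀ j → ι (f j) ≡ δ x j))
enum₁ f e with pick f (≤-reflexive (≡.sym e))
... | x , fx = x , fx , λ j → trans (ι-without x f fx j) (trans (cong (δ x j +_) (sum≡0 (ι ∘ without f x) (suc-injective (trans (≡.sym (sum-without f x fx)) e)) j)) (+-identityʳ _))

enum₂ : (f : Fin n → Bool) → sum (ι ∘ f) ≡ 2 → ∃[ x ] ∃[ y ] (∀ j → ι (f j) ≡ δ x j + δ y j)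
enum₂ f e with pick f (≤-trans (s≤s z≤n) (≤-reflexive (≡.sym e)))
... | x , fx with enum₁ (without f x) (suc-injective (trans (≡.sym (sum-without f x fx)) e))
...   | y , gy , h = x , y , λ j → trans (ι-without x f fx j) (cong (δ x j +_) (h j))

enum₃ : (f : Fin n → Bool) → sum (ι ∘ f) ≡ 3 → ∃[ x ] ∃[ y ] ∃[ z ] (∀ j → ι (f j) ≡ δ x j + (δ y j + δ z j))
enum₃ f e with pick f (≤-trans (s≤s z≤n) (≤-reflexive (≡.sym e)))
... | x , fx with enum₂ (without f x) (suc-injective (trans (≡.sym (sum-without f x fx)) e))
...   | y , z , h = x , y , z , λ j → trans (ι-without x f fx j) (cong (δ x j +_) (h j))

argmin : (f : Fin (suc n) → ℕ) → ∃[ x ] (∀ j → f x ≤ f j)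
argmin {zero}  f = zero , λ { zero → ≤-refl }
argmin {suc n} f with argmin (f ∘ suc)
... | x , h with f zero ≤? f (suc x)
...   | yes p = zero , λ { zero → ≤-refl ; (suc j) → ≤-trans p (h j) }
...   | no ¬p = suc x , λ { zero → <⇒≤ (≰⇒> ¬p) ; (suc j) → h j }

-- Degrees

deg : SimpleGraph n → Fin n → ℕ
deg G i = sum (ι ∘ adj G i)

degree≡deg : (G : SimpleGraph n) (i : Fin n) → degree G i ≡ deg G i
degree≡deg G i = listSum≡sum (ι ∘ adj G i)

adj-≢ : (G : SimpleGraph n) {i j : Fin n} → adj G i j ≡ true → i ≢ j
adj-≢ G {i} e refl = true≢false e (irrfl G i)

adj-sym : (G : SimpleGraph n) {i j : Fin n} {b : Bool} → adj G i j ≡ b → adj G j i ≡ b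
adj-sym G {i} {j} e = trans (sym G j i) e

-- Adding `δ i` to row `i` keeps every entry at most 1, because the diagonal entry is 0.
deg≤ : (G : SimpleGraph (suc m)) (i : Fin (suc m)) → deg G i ≤ m
deg≤ {m} G i = ≤-from (deg G i) m 0 bound (eq (deg G i) m)
  where
  pointwise : ∀ j → ι (adj G i j) + δ i j ≤ 1
  pointwise j with i ≟ j
  ... | yes refl rewrite irrfl G i = ≤-refl
  ... | no _ = ≤-trans (≤-reflexive (+-identityʳ _)) (ι≤1 (adj G i j))
  bound : deg G i + 1 ≤ suc m · 1
  bound = begin
    deg G i + 1                    ≡⟨ cong (deg G i +_) (sum-δ i) ⟨
    deg G i + sum (δ i)            ≡⟨ ∑-distrib-+ (ι ∘ adj G i) (δ i) ⟨
    sum (λ j → ι (adj G i j) + δ i j) ≤⟨ sum-mono pointwise ⟩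
    sum {suc m} (λ _ → 1)          ≡⟨ sum-const (suc m) 1 ⟩
    suc m · 1                      ∎
    where open ≤-Reasoning
  eq : ∀ d m → d + suc m · 1 + 0 ≡ m + (d + 1)
  eq = solve-∀

-- Single edges and 2-switches

isEdge : Fin n → Fin n → Fin n → Fin n → Bool
isEdge u v i j = (u == i) ∧ (v == j) ∨ (v == i) ∧ (u == j)

isEdge-sym : (u v i j : Fin n) → isEdge u v i j ≡ isEdge u v j i
isEdge-sym u v i j = trans (∨-comm ((u == i) ∧ (v == j)) _) (cong₂ _∨_ (∧-comm (v == i) _) (∧-comm (u == i) _))

isEdge-irrefl : {u v : Fin n} → u ≢ v → ∀ i → isEdge u v i i ≡ false
isEdge-irrefl {u = u} {v} u≢v i with u ≟ i | v ≟ i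
... | yes refl | yes refl = contradiction refl u≢v
... | yes _ | no _ = refl
... | no _ | yes _ = refl
... | no _ | no _ = refl

isEdge-sound : (u v i j : Fin n) → isEdge u v i j ≡ true → (u ≡ i × v ≡ j) ⊎ (v ≡ i × u ≡ j)
isEdge-sound u v i j e with ∨-elim e
... | inj₁ p = inj₁ (==-sound (∧-elimˡ p) , ==-sound (∧-elimʳ p))
... | inj₂ p = inj₂ (==-sound (∧-elimˡ p) , ==-sound (∧-elimʳ p))

isEdge-self : (u v : Fin n) → isEdge u v u v ≡ true
isEdge-self u v rewrite ==-refl u | ==-refl v = refl

isEdge-other : (u v i j : Fin n) → ¬ ((u ≡ i × v ≡ j) ⊎ (v ≡ i × u ≡ j)) → isEdge u v i j ≡ false
isEdge-other u v i j h with isEdge u v i j in e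
... | true  = contradiction (isEdge-sound u v i j e) h
... | false = refl

ι-isEdge : {u v : Fin n} → u ≢ v → ∀ i j → ι (isEdge u v i j) ≡ δ u i · δ v j + δ v i · δ u j
ι-isEdge {u = u} {v} u≢v i j with u ≟ i | v ≟ i | u ≟ j | v ≟ j
... | yes refl | yes refl | _ | _ = contradiction refl u≢v
... | yes _ | no _ | _ | yes _ = refl
... | yes _ | no _ | _ | no _ = refl
... | no _ | yes _ | yes _ | _ = refl
... | no _ | yes _ | no _ | _ = refl
... | no _ | no _ | _ | _ = refl

sum-isEdge : {u v : Fin n} → u ≢ v → ∀ i → sum (λ j → ι (isEdge u v i j)) ≡ δ u i + δ v i
sum-isEdge {u = u} {v} u≢v i = begin
  sum (λ j → ι (isEdge u v i j))                        ≡⟨ sum-cong-≗ (ι-isEdge u≢v i) ⟩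
  sum (λ j → δ u i · δ v j + δ v i · δ u j)             ≡⟨ ∑-distrib-+ (λ j → δ u i · δ v j) _ ⟩
  sum (λ j → δ u i · δ v j) + sum (λ j → δ v i · δ u j) ≡⟨ cong₂ _+_ (scaled u v) (scaled v u) ⟩
  δ u i + δ v i                                         ∎
  where
  open ≡.≡-Reasoning
  scaled : ∀ x y → sum (λ j → δ x i · δ y j) ≡ δ x i
  scaled x y = trans (sum-·ˡ (δ x i) (δ y)) (trans (cong (δ x i ·_) (sum-δ y)) (*-identityʳ _))

setEdge : Bool → SimpleGraph n → (u v : Fin n) → u ≢ v → SimpleGraph n
setEdge b G u v u≢v .adj i j = if isEdge u v i j then b else adj G i j
setEdge b G u v u≢v .sym i j rewrite isEdge-sym u v i j | sym G i j = refl
setEdge b G u v u≢v .irrfl i rewrite isEdge-irrefl u≢v i = irrfl G i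

addEdge removeEdge : SimpleGraph n → (u v : Fin n) → u ≢ v → SimpleGraph n
addEdge    = setEdge true
removeEdge = setEdge false

setEdge-other : ∀ b (G : SimpleGraph n) {u v} (u≢v : u ≢ v) i j → ¬ ((u ≡ i × v ≡ j) ⊎ (v ≡ i × u ≡ j)) → adj (setEdge b G u v u≢v) i j ≡ adj G i j
setEdge-other b G {u} {v} u≢v i j h rewrite isEdge-other u v i j h = refl

setEdge-self : ∀ b (G : SimpleGraph n) {u v} (u≢v : u ≢ v) → adj (setEdge b G u v u≢v) u v ≡ b
setEdge-self b G {u} {v} u≢v rewrite isEdge-self u v = refl

adj-on-edge : (G : SimpleGraph n) {u v : Fin n} {b : Bool} → adj G u v ≡ b → ∀ i j → isEdge u v i j ≡ true → adj G i j ≡ b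
adj-on-edge G {u} {v} e i j p with isEdge-sound u v i j p
... | inj₁ (refl , refl) = e
... | inj₂ (refl , refl) = adj-sym G e

deg-addEdge : (G : SimpleGraph n) {u v : Fin n} (u≢v : u ≢ v) → adj G u v ≡ false →
  ∀ i → deg (addEdge G u v u≢v) i ≡ deg G i + (δ u i + δ v i)
deg-addEdge G {u} {v} u≢v e i = trans (sum-cong-≗ pointwise) (trans (∑-distrib-+ (ι ∘ adj G i) _) (cong (deg G i +_) (sum-isEdge u≢v i)))
  where
  pointwise : ∀ j → ι (adj (addEdge G u v u≢v) i j) ≡ ι (adj G i j) + ι (isEdge u v i j)
  pointwise j with isEdge u v i j in p
  ... | true  rewrite adj-on-edge G e i j p = refl
  ... | false = ≡.sym (+-identityʳ _)

deg-removeEdge : (G : SimpleGraph n) {u v : Fin n} (u≢v : u ≢ v) → adj G u v ≡ true →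
  ∀ i → deg G i ≡ deg (removeEdge G u v u≢v) i + (δ u i + δ v i)
deg-removeEdge G {u} {v} u≢v e i = trans (sum-cong-≗ pointwise) (trans (∑-distrib-+ (ι ∘ adj (removeEdge G u v u≢v) i) _) (cong (deg (removeEdge G u v u≢v) i +_) (sum-isEdge u≢v i)))
  where
  pointwise : ∀ j → ι (adj G i j) ≡ ι (adj (removeEdge G u v u≢v) i j) + ι (isEdge u v i j)
  pointwise j with isEdge u v i j in p
  ... | true  rewrite adj-on-edge G e i j p = refl
  ... | false = ≡.sym (+-identityʳ _)

-- The edges `ab`, `xy` are traded for `ax`, `by`, one at a time. Only `a ≢ x` and `b ≢ y` have to
-- be supplied; the other inequalities follow from the adjacencies.
module Switch (G : SimpleGraph n) {a b x y : Fin n} (ab : adj G a b ≡ true) (xy : adj G x y ≡ true)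
  (ax : adj G a x ≡ false) (by : adj G b y ≡ false) (a≢x : a ≢ x) (b≢y : b ≢ y) where

  a≢b : a ≢ b
  a≢b = adj-≢ G ab
  x≢y : x ≢ y
  x≢y = adj-≢ G xy
  a≢y : a ≢ y
  a≢y refl = true≢false xy (adj-sym G ax)
  b≢x : b ≢ x
  b≢x refl = true≢false ab ax

  G₁ = removeEdge G a b a≢b
  G₂ = removeEdge G₁ x y x≢y
  G₃ = addEdge G₂ a x a≢x

  switch : SimpleGraph n
  switch = addEdge G₃ b y b≢y

  private
    e₁ : adj G₁ x y ≡ true
    e₁ = trans (setEdge-other false G a≢b x y λ { (inj₁ (p , _)) → a≢x p ; (inj₂ (p , _)) → b≢x p }) xy
    e₂ : adj G₂ a x ≡ false
    e₂ = trans (setEdge-other false G₁ x≢y a x λ { (inj₁ (p , _)) → a≢x (≡.sym p) ; (inj₂ (p , _)) → a≢y (≡.sym p) })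
        (trans (setEdge-other false G a≢b a x λ { (inj₁ (_ , p)) → b≢x p ; (inj₂ (p , _)) → a≢b (≡.sym p) }) ax)
    e₃ : adj G₃ b y ≡ false
    e₃ = trans (setEdge-other true G₂ a≢x b y λ { (inj₁ (p , _)) → a≢b p ; (inj₂ (p , _)) → b≢x (≡.sym p) })
        (trans (setEdge-other false G₁ x≢y b y λ { (inj₁ (p , _)) → b≢x (≡.sym p) ; (inj₂ (p , _)) → b≢y (≡.sym p) })
        (trans (setEdge-other false G a≢b b y λ { (inj₁ (p , _)) → a≢b p ; (inj₂ (_ , p)) → a≢y p }) by))

  deg-switch : ∀ i → deg switch i ≡ deg G i
  deg-switch i = trans (trans (deg-addEdge G₃ b≢y e₃ i) (cong (_+ (δ b i + δ y i)) (deg-addEdge G₂ a≢x e₂ i)))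
    (trans (shuffle (deg G₂ i) (δ a i) (δ b i) (δ x i) (δ y i))
    (≡.sym (trans (deg-removeEdge G a≢b ab i) (cong (_+ (δ a i + δ b i)) (deg-removeEdge G₁ x≢y e₁ i)))))
    where
    shuffle : ∀ d a b x y → d + (a + x) + (b + y) ≡ d + (x + y) + (a + b)
    shuffle = solve-∀

  switch-ab : adj switch a b ≡ false
  switch-ab = trans (setEdge-other true G₃ b≢y a b λ { (inj₁ (p , _)) → a≢b (≡.sym p) ; (inj₂ (p , _)) → a≢y (≡.sym p) })
    (trans (setEdge-other true G₂ a≢x a b λ { (inj₁ (_ , p)) → b≢x (≡.sym p) ; (inj₂ (p , _)) → a≢x (≡.sym p) })
    (trans (setEdge-other false G₁ x≢y a b λ { (inj₁ (p , _)) → a≢x (≡.sym p) ; (inj₂ (p , _)) → a≢y (≡.sym p) })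
    (setEdge-self false G a≢b)))

  switch-ax : adj switch a x ≡ true
  switch-ax = trans (setEdge-other true G₃ b≢y a x λ { (inj₁ (p , _)) → a≢b (≡.sym p) ; (inj₂ (p , _)) → a≢y (≡.sym p) })
    (setEdge-self true G₂ a≢x)

  switch-a : ∀ j → (b ≢ j) → (x ≢ j) → adj switch a j ≡ adj G a j
  switch-a j b≢ x≢ =
    trans (setEdge-other true G₃ b≢y a j λ { (inj₁ (p , _)) → a≢b (≡.sym p) ; (inj₂ (p , _)) → a≢y (≡.sym p) })
    (trans (setEdge-other true G₂ a≢x a j λ { (inj₁ (_ , p)) → x≢ p ; (inj₂ (p , _)) → a≢x (≡.sym p) })
    (trans (setEdge-other false G₁ x≢y a j λ { (inj₁ (p , _)) → a≢x (≡.sym p) ; (inj₂ (p , _)) → a≢y (≡.sym p) })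
    (setEdge-other false G a≢b a j λ { (inj₁ (_ , p)) → b≢ p ; (inj₂ (p , _)) → a≢b (≡.sym p) })))

-- Deleting and adding a vertex; the degree sum

restrict : SimpleGraph (suc n) → SimpleGraph n
restrict G .adj i j = adj G (suc i) (suc j)
restrict G .sym i j = sym G (suc i) (suc j)
restrict G .irrfl i = irrfl G (suc i)

extend : SimpleGraph n → (Fin n → Bool) → SimpleGraph (suc n)
extend H r .adj zero    zero    = false
extend H r .adj zero    (suc j) = r j
extend H r .adj (suc i) zero    = r i
extend H r .adj (suc i) (suc j) = adj H i j
extend H r .sym zero    zero    = refl
extend H r .sym zero    (suc j) = refl
extend H r .sym (suc i) zero    = refl
extend H r .sym (suc i) (suc j) = sym H i j
extend H r .irrfl zero    = refl
extend H r .irrfl (suc i) = irrfl H i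

deg-zero : (G : SimpleGraph (suc n)) → deg G zero ≡ sum (λ j → ι (adj G zero (suc j)))
deg-zero G rewrite irrfl G zero = refl

deg-suc : (G : SimpleGraph (suc n)) (i : Fin n) → deg G (suc i) ≡ ι (adj G zero (suc i)) + deg (restrict G) i
deg-suc G i = cong (λ b → ι b + deg (restrict G) i) (sym G (suc i) zero)

total : SimpleGraph n → ℕ
total G = sum (deg G)

-- Each edge at `zero` contributes at both of its ends.
total-restrict : (G : SimpleGraph (suc n)) → total G ≡ deg G zero + deg G zero + total (restrict G)
total-restrict G = begin
  deg G zero + sum (deg G ∘ suc)                                              ≡⟨ cong (deg G zero +_) (sum-cong-≗ (deg-suc G)) ⟩
  deg G zero + sum (λ i → ι (adj G zero (suc i)) + deg (restrict G) i)        ≡⟨ cong (deg G zero +_) (∑-distrib-+ _ (deg (restrict G))) ⟩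
  deg G zero + (sum (λ i → ι (adj G zero (suc i))) + total (restrict G))      ≡⟨ cong (λ k → deg G zero + (k + total (restrict G))) (≡.sym (deg-zero G)) ⟩
  deg G zero + (deg G zero + total (restrict G))                              ≡⟨ +-assoc (deg G zero) _ _ ⟨
  deg G zero + deg G zero + total (restrict G)                                ∎
  where open ≡.≡-Reasoning

total-even : (G : SimpleGraph n) → ∃[ e ] total G ≡ e + e
total-even {zero}  G = 0 , refl
total-even {suc n} G with total-even (restrict G)
... | e , p = deg G zero + e , trans (total-restrict G) (trans (cong (deg G zero + deg G zero +_) p) (shuffle (deg G zero) e))
  where
  shuffle : ∀ d e → d + d + (e + e) ≡ d + e + (d + e)
  shuffle = solve-∀

-- Walks and connectedness

walk-++ : {G : SimpleGraph n} {u v w : Fin n} → Walk G u v → Walk G v w → Walk G u w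
walk-++ here       q = q
walk-++ (step e p) q = step e (walk-++ p q)

walk-reverse : (G : SimpleGraph n) {u v : Fin n} → Walk G u v → Walk G v u
walk-reverse G here       = here
walk-reverse G (step e p) = walk-++ (walk-reverse G p) (step (adj-sym G e) here)

walk-map : {G : SimpleGraph n} {H : SimpleGraph m} (f : Fin n → Fin m) →
  (∀ i j → adj G i j ≡ true → Walk H (f i) (f j)) → ∀ {u v} → Walk G u v → Walk H (f u) (f v)
walk-map f h here       = here
walk-map f h (step e p) = walk-++ (h _ _ e) (walk-map f h p)

connected-from : (G : SimpleGraph n) (r : Fin n) → (∀ u → Walk G u r) → Connected G
connected-from G r h u v = walk-++ (h u) (walk-reverse G (h v))

-- Packings of two connected subgraphs

Shared : SimpleGraph n → SimpleGraph n → Fin n → Fin n → Set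
Shared C₁ C₂ i j = adj C₁ i j ≡ true × adj C₂ i j ≡ true

SameEdge : (i j k l : Fin n) → Set
SameEdge i j k l = (i ≡ k × j ≡ l) ⊎ (i ≡ l × j ≡ k)

-- At most one shared edge if s is true, none if s is false.
Share : Bool → SimpleGraph n → SimpleGraph n → Set
Share s C₁ C₂ = ∀ i j k l → Shared C₁ C₂ i j → Shared C₁ C₂ k l → s ≡ true × SameEdge i j k l

-- Stated for a degree function, since the realization changes during the induction. Connectedness
-- is enough: passing to spanning trees later creates no new shared edge.
Packs : Bool → (Fin n → ℕ) → Set
Packs s d = ∃[ H ] ((∀ i → deg H i ≡ d i) × ∃[ C₁ ] ∃[ C₂ ]
  (Subgraph C₁ H × Subgraph C₂ H × Connected C₁ × Connected C₂ × Share s C₁ C₂))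

packs-cong : ∀ {s} {d d′ : Fin n → ℕ} → (∀ i → d i ≡ d′ i) → Packs s d → Packs s d′
packs-cong e (H , r , rest) = H , (λ i → trans (r i) (e i)) , rest

-- Relabelling vertices

relabel : Permutation n n → SimpleGraph n → SimpleGraph n
relabel π G .adj i j = adj G (π ⟨$⟩ʳ i) (π ⟨$⟩ʳ j)
relabel π G .sym i j = sym G (π ⟨$⟩ʳ i) (π ⟨$⟩ʳ j)
relabel π G .irrfl i = irrfl G (π ⟨$⟩ʳ i)

deg-relabel : (π : Permutation n n) (G : SimpleGraph n) (i : Fin n) → deg (relabel π G) i ≡ deg G (π ⟨$⟩ʳ i)
deg-relabel π G i = ≡.sym (sum-permute (ι ∘ adj G (π ⟨$⟩ʳ i)) π)

total-relabel : (π : Permutation n n) (G : SimpleGraph n) → total (relabel π G) ≡ total G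
total-relabel π G = trans (sum-cong-≗ (deg-relabel π G)) (≡.sym (sum-permute (deg G) π))

connected-relabel : (π : Permutation n n) (G : SimpleGraph n) → Connected G → Connected (relabel π G)
connected-relabel π G c u v = ≡.subst₂ (Walk (relabel π G)) (inverseˡ π) (inverseˡ π)
  (walk-map (π ⟨$⟩ˡ_) (λ i j e → step (≡.subst₂ (λ a b → adj G a b ≡ true) (≡.sym (inverseʳ π)) (≡.sym (inverseʳ π)) e) here) (c (π ⟨$⟩ʳ u) (π ⟨$⟩ʳ v)))

perm-injective : (π : Permutation n n) {i j : Fin n} → π ⟨$⟩ʳ i ≡ π ⟨$⟩ʳ j → i ≡ j
perm-injective π e = trans (≡.sym (inverseˡ π)) (trans (cong (π ⟨$⟩ˡ_) e) (inverseˡ π))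

packs-relabel : ∀ {s} (π : Permutation n n) {d : Fin n → ℕ} → Packs s d → Packs s (λ i → d (π ⟨$⟩ʳ i))
packs-relabel π (H , r , C₁ , C₂ , s₁ , s₂ , c₁ , c₂ , sh) =
  relabel π H , (λ i → trans (deg-relabel π H i) (r _)) , relabel π C₁ , relabel π C₂ ,
  (λ i j → s₁ _ _) , (λ i j → s₂ _ _) , connected-relabel π C₁ c₁ , connected-relabel π C₂ c₂ ,
  λ i j k l p q → map₂ (Data.Sum.map (inj×) (inj×)) (sh _ _ _ _ p q)
  where
  inj× : ∀ {a b c d} → (π ⟨$⟩ʳ a ≡ π ⟨$⟩ʳ b) × (π ⟨$⟩ʳ c ≡ π ⟨$⟩ʳ d) → a ≡ b × c ≡ d
  inj× (p , q) = perm-injective π p , perm-injective π q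

bring-to-front : Fin (suc n) → Permutation (suc n) (suc n)
bring-to-front v = transpose zero v

-- Lets any vertex play the role of `zero`: the packing found after the transposition is carried
-- back along its inverse.
packs-at : ∀ {s} (v : Fin (suc n)) (G : SimpleGraph (suc n)) → Packs s (deg (relabel (bring-to-front v) G)) → Packs s (deg G)
packs-at v G p = packs-cong eq (packs-relabel (flip π) p)
  where
  π = bring-to-front v
  eq : ∀ i → deg (relabel π G) (flip π ⟨$⟩ʳ i) ≡ deg G i
  eq i = trans (deg-relabel π G (flip π ⟨$⟩ʳ i)) (cong (deg G) (inverseʳ π))

-- Extending a packing by a new vertex

connected-pendant : (C : SimpleGraph n) (r : Fin n → Bool) {x : Fin n} → r x ≡ true → Connected C → Connected (extend C r)
connected-pendant C r {x} rx c = connected-from (extend C r) (suc x) λ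
  { zero    → step rx here
  ; (suc i) → walk-map suc (λ _ _ e → step e here) (c i x) }

-- A walk that used the edge `uw` makes a detour through `zero` instead.
connected-subdivide : (C : SimpleGraph n) (r : Fin n → Bool) {u w : Fin n} (u≢w : u ≢ w) → r u ≡ true → r w ≡ true →
  Connected C → Connected (extend (removeEdge C u w u≢w) r)
connected-subdivide C r {u} {w} u≢w ru rw c = connected-from (extend C⁻ r) (suc u) λ
  { zero    → step ru here
  ; (suc i) → walk-map suc detour (c i u) }
  where
  C⁻ = removeEdge C u w u≢w
  detour : ∀ i j → adj C i j ≡ true → Walk (extend C⁻ r) (suc i) (suc j)
  detour i j e with isEdge u w i j in p
  ... | false = step (trans (cong (if_then false else adj C i j) p) e) here
  ... | true with isEdge-sound u w i j p
  ...   | inj₁ (refl , refl) = step {v = zero} ru (step rw here)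
  ...   | inj₂ (refl , refl) = step {v = zero} rw (step ru here)

SameEdge-suc : {i j k l : Fin n} → SameEdge i j k l → SameEdge (suc i) (suc j) (suc k) (suc l)
SameEdge-suc (inj₁ (refl , refl)) = inj₁ (refl , refl)
SameEdge-suc (inj₂ (refl , refl)) = inj₂ (refl , refl)

share-extend : ∀ {s} {C₁ C₂ : SimpleGraph n} {r₁ r₂ : Fin n → Bool} →
  (∀ j → r₁ j ≡ true → r₂ j ≡ true → ⊥) → Share s C₁ C₂ → Share s (extend C₁ r₁) (extend C₂ r₂)
share-extend dis sh zero    zero    _ _ (() , _) _
share-extend dis sh zero    (suc j) _ _ (p , q) _ = ⊥-elim (dis j p q)
share-extend dis sh (suc i) zero    _ _ (p , q) _ = ⊥-elim (dis i p q)
share-extend dis sh (suc i) (suc j) zero    zero    _ (() , _)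
share-extend dis sh (suc i) (suc j) zero    (suc l) _ (p , q) = ⊥-elim (dis l p q)
share-extend dis sh (suc i) (suc j) (suc k) zero    _ (p , q) = ⊥-elim (dis k p q)
share-extend dis sh (suc i) (suc j) (suc k) (suc l) p q =
  let e , same = sh i j k l p q in e , SameEdge-suc same

share-sub : ∀ {s} {C₁ C₂ D₁ D₂ : SimpleGraph n} → Subgraph D₁ C₁ → Subgraph D₂ C₂ → Share s C₁ C₂ → Share s D₁ D₂
share-sub s₁ s₂ sh i j k l (p , q) (p′ , q′) = sh i j k l (s₁ i j p , s₂ i j q) (s₁ k l p′ , s₂ k l q′)

share-swap : ∀ {s} {C₁ C₂ : SimpleGraph n} → Share s C₁ C₂ → Share s C₂ C₁
share-swap sh i j k l (p , q) (p′ , q′) = sh i j k l (q , p) (q′ , p′)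

-- The edges `ax` and `ay` are distinct, so they cannot both be shared.
unshared-edge : ∀ {s} (C₁ C₂ : SimpleGraph n) → Share s C₁ C₂ → ∀ a {x y} → x ≢ y →
  (adj C₁ a x ≡ false ⊎ adj C₂ a x ≡ false) ⊎ (adj C₁ a y ≡ false ⊎ adj C₂ a y ≡ false)
unshared-edge C₁ C₂ sh a {x} {y} x≢y with adj C₁ a x in e₁ | adj C₂ a x in e₂ | adj C₁ a y in e₃ | adj C₂ a y in e₄
... | false | _ | _ | _ = inj₁ (inj₁ refl)
... | true | false | _ | _ = inj₁ (inj₂ refl)
... | true | true | false | _ = inj₂ (inj₁ refl)
... | true | true | true | false = inj₂ (inj₂ refl)
... | true | true | true | true with sh a x a y (e₁ , e₂) (e₃ , e₄)
...   | _ , inj₁ (_ , p) = contradiction p x≢y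
...   | _ , inj₂ (p , _) = contradiction p (adj-≢ C₁ e₃)

subgraph-extend : {C H : SimpleGraph n} {r r′ : Fin n → Bool} → Subgraph C H → (∀ j → r j ≡ true → r′ j ≡ true) → Subgraph (extend C r) (extend H r′)
subgraph-extend s t zero    (suc j) = t j
subgraph-extend s t (suc i) zero    = t i
subgraph-extend s t (suc i) (suc j) = s i j

subgraph-removeEdge : (C : SimpleGraph n) {u w : Fin n} (u≢w : u ≢ w) → Subgraph (removeEdge C u w u≢w) C
subgraph-removeEdge C {u} {w} u≢w i j e with isEdge u w i j
... | false = e

removeEdge-mono : {C H : SimpleGraph n} {u w : Fin n} (u≢w : u ≢ w) → Subgraph C H → Subgraph (removeEdge C u w u≢w) (removeEdge H u w u≢w)
removeEdge-mono {u = u} {w} u≢w s i j e with isEdge u w i j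
... | false = s i j e

subgraph-avoiding : {C H : SimpleGraph n} {u w : Fin n} (u≢w : u ≢ w) → adj C u w ≡ false → Subgraph C H → Subgraph C (removeEdge H u w u≢w)
subgraph-avoiding {C = C} {u = u} {w} u≢w f s i j e with isEdge u w i j in p
... | false = s i j e
... | true  = ⊥-elim (true≢false e (adj-on-edge C f i j p))

nbr : SimpleGraph (suc n) → Fin n → Bool
nbr G j = adj G zero (suc j)

deg-extend-same : (G : SimpleGraph (suc n)) (H : SimpleGraph n) → (∀ i → deg H i ≡ deg (restrict G) i) →
  ∀ i → deg (extend H (nbr G)) i ≡ deg G i
deg-extend-same G H r zero    = ≡.sym (deg-zero G)
deg-extend-same G H r (suc i) = trans (cong (ι (nbr G i) +_) (r i)) (≡.sym (deg-suc G i))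

-- `C₁` receives the edge from `zero` to one neighbour and `C₂` the edge to another, so no new edge
-- is shared. All further edges at `zero` stay outside both.
packs-vertex : ∀ {s} (G : SimpleGraph (suc n)) → 2 ≤ deg G zero → Packs s (deg (restrict G)) → Packs s (deg G)
packs-vertex G 2≤d (H , r , C₁ , C₂ , s₁ , s₂ , c₁ , c₂ , sh) with pick₂ (nbr G) (≤-trans 2≤d (≤-reflexive (deg-zero G)))
... | x , y , rx , ry , x≢y =
  extend H (nbr G) , deg-extend-same G H r , extend C₁ (x ==_) , extend C₂ (y ==_) ,
  subgraph-extend s₁ (at-vertex rx) , subgraph-extend s₂ (at-vertex ry) ,
  connected-pendant C₁ (x ==_) (==-refl x) c₁ , connected-pendant C₂ (y ==_) (==-refl y) c₂ ,
  share-extend (λ j p q → x≢y (trans (==-sound p) (≡.sym (==-sound q)))) sh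
  where
  at-vertex : ∀ {x} → nbr G x ≡ true → ∀ j → (x == j) ≡ true → nbr G j ≡ true
  at-vertex rx j p = subst (λ k → nbr G k ≡ true) (==-sound p) rx

-- Both subgraphs must use the only edge at `zero`. It takes up the one permitted shared edge, hence
-- the packing of the rest may share none.
packs-leaf : (G : SimpleGraph (suc n)) → deg G zero ≡ 1 → Packs false (deg (restrict G)) → Packs true (deg G)
packs-leaf G d≡1 (H , r , C₁ , C₂ , s₁ , s₂ , c₁ , c₂ , sh) with enum₁ (nbr G) (trans (≡.sym (deg-zero G)) d≡1)
... | x , rx , only =
  extend H (nbr G) , deg-extend-same G H r , extend C₁ (nbr G) , extend C₂ (nbr G) ,
  subgraph-extend s₁ (λ _ p → p) , subgraph-extend s₂ (λ _ p → p) ,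
  connected-pendant C₁ (nbr G) rx c₁ , connected-pendant C₂ (nbr G) rx c₂ , share
  where
  is-x : ∀ j → nbr G j ≡ true → j ≡ x
  is-x j p with x ≟ j | only j
  ... | yes q | _ = ≡.sym q
  ... | no _  | e rewrite p with e
  ...   | ()
  -- Comparing a shared edge with itself already yields `false ≡ true`.
  no-inner : ∀ {A : Set} i j → Shared C₁ C₂ i j → A
  no-inner i j p with sh i j i j p p
  ... | () , _
  share : Share true (extend C₁ (nbr G)) (extend C₂ (nbr G))
  share zero    (suc j) zero    (suc l) (p , _) (q , _) = refl , inj₁ (refl , cong suc (trans (is-x j p) (≡.sym (is-x l q))))
  share zero    (suc j) (suc k) zero    (p , _) (q , _) = refl , inj₂ (refl , cong suc (trans (is-x j p) (≡.sym (is-x k q))))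
  share zero    (suc j) (suc k) (suc l) _ q = no-inner k l q
  share (suc i) zero    zero    (suc l) (p , _) (q , _) = refl , inj₂ (cong suc (trans (is-x i p) (≡.sym (is-x l q))) , refl)
  share (suc i) zero    (suc k) zero    (p , _) (q , _) = refl , inj₁ (cong suc (trans (is-x i p) (≡.sym (is-x k q))) , refl)
  share (suc i) zero    (suc k) (suc l) _ q = no-inner k l q
  share (suc i) (suc j) _ _ p _ = no-inner i j p

-- Vertices of degree 3 and pinching

δ-self : (x : Fin n) → δ x x ≡ 1
δ-self x = cong ι (==-refl x)

δ≡0⇒≢ : {x y : Fin n} → δ x y ≡ 0 → x ≢ y
δ≡0⇒≢ {x = x} e refl rewrite ==-refl x with e
... | ()

-- One equation of indicators expresses that the set is `{a, b, c}` and that its three members are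
-- distinct.
record Row₃ (f : Fin n → Bool) (a b c : Fin n) : Set where
  constructor row₃
  field indicator : ∀ j → ι (f j) ≡ δ a j + (δ b j + δ c j)
open Row₃

-- At `j = a` the left side is at most 1 and `δ a a` uses it up, so the other two terms vanish. The
-- facts about `b` and `c` come from rotating the row.
row₃-head : {f : Fin n → Bool} {a b c : Fin n} → Row₃ f a b c → f a ≡ true × b ≢ a × c ≢ a
row₃-head {f = f} {a} {b} {c} row with f a | indicator row a
... | fa | e rewrite δ-self a with fa
...   | true = refl , δ≡0⇒≢ {x = b} (m+n≡0⇒m≡0 _ (suc-injective (≡.sym e))) , δ≡0⇒≢ {x = c} (m+n≡0⇒n≡0 (δ b a) (suc-injective (≡.sym e)))

row₃-rotate : {f : Fin n → Bool} {a b c : Fin n} → Row₃ f a b c → Row₃ f b c a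
row₃-rotate {a = a} {b} {c} row = row₃ λ j → trans (indicator row j) (shuffle (δ a j) (δ b j) (δ c j))
  where
  shuffle : ∀ a b c → a + (b + c) ≡ b + (c + a)
  shuffle = solve-∀

row₃-sum : {f : Fin n → Bool} {a b c : Fin n} → Row₃ f a b c → (g : Fin n → ℕ) → sum (λ j → ι (f j) · g j) ≡ g a + (g b + g c)
row₃-sum {f = f} {a} {b} {c} row g = begin
  sum (λ j → ι (f j) · g j)                                                    ≡⟨ sum-cong-≗ (λ j → trans (cong (_· g j) (indicator row j)) (expand (δ a j) (δ b j) (δ c j) (g j))) ⟩
  sum (λ j → δ a j · g j + (δ b j · g j + δ c j · g j))                        ≡⟨ ∑-distrib-+ (λ j → δ a j · g j) _ ⟩
  sum (λ j → δ a j · g j) + sum (λ j → δ b j · g j + δ c j · g j)              ≡⟨ cong (sum (λ j → δ a j · g j) +_) (∑-distrib-+ (λ j → δ b j · g j) _) ⟩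
  sum (λ j → δ a j · g j) + (sum (λ j → δ b j · g j) + sum (λ j → δ c j · g j)) ≡⟨ cong₂ _+_ (sum-pick a g) (cong₂ _+_ (sum-pick b g) (sum-pick c g)) ⟩
  g a + (g b + g c)                                                            ∎
  where
  open ≡.≡-Reasoning
  expand : ∀ a b c g → (a + (b + c)) · g ≡ a · g + (b · g + c · g)
  expand = solve-∀

row₃-size : {f : Fin n → Bool} {a b c : Fin n} → Row₃ f a b c → sum (ι ∘ f) ≡ 3
row₃-size {f = f} row = trans (sum-cong-≗ (λ j → ≡.sym (*-identityʳ (ι (f j))))) (row₃-sum row (λ _ → 1))

row₃-member : {f : Fin n → Bool} {a b c : Fin n} → Row₃ f a b c → ∀ j → f j ≡ true → j ≡ a ⊎ j ≡ b ⊎ j ≡ c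
row₃-member {a = a} {b} {c} row j fj with a ≟ j | b ≟ j | c ≟ j | indicator row j
... | yes p | _ | _ | _ = inj₁ (≡.sym p)
... | no _ | yes p | _ | _ = inj₂ (inj₁ (≡.sym p))
... | no _ | no _ | yes p | _ = inj₂ (inj₂ (≡.sym p))
... | no _ | no _ | no _ | e rewrite fj with e
...   | ()

three : Fin n → Fin n → Fin n → Fin n → Bool
three u w c j = (u == j) ∨ (w == j) ∨ (c == j)

row₃-three : {u w c : Fin n} → u ≢ w → u ≢ c → w ≢ c → Row₃ (three u w c) u w c
row₃-three {u = u} {w} {c} u≢w u≢c w≢c = row₃ split
  where
  split : ∀ j → ι (three u w c j) ≡ δ u j + (δ w j + δ c j)
  split j with u ≟ j | w ≟ j | c ≟ j
  ... | yes refl | yes refl | _ = contradiction refl u≢w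
  ... | yes refl | no _ | yes refl = contradiction refl u≢c
  ... | no _ | yes refl | yes refl = contradiction refl w≢c
  ... | yes _ | no _ | no _ = refl
  ... | no _ | yes _ | no _ = refl
  ... | no _ | no _ | yes _ = refl
  ... | no _ | no _ | no _ = refl

-- The inverse of "delete a vertex of degree 3 with neighbours a, b, c and
-- join a to b": an edge uw avoiding c is subdivided by the vertex zero,
-- which is also joined to c.
module Pinch (G : SimpleGraph (suc n)) {a b c : Fin n} (row : Row₃ (nbr G) a b c)
  (a≢b : a ≢ b) (ab : adj (restrict G) a b ≡ false) {s : Bool} where

  G′ : SimpleGraph n
  G′ = addEdge (restrict G) a b a≢b

  deg-zero≡3 : deg G zero ≡ 3
  deg-zero≡3 = trans (deg-zero G) (row₃-size row)

  a≢c : a ≢ c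
  a≢c p = proj₂ (proj₂ (row₃-head row)) (≡.sym p)

  -- The vertex of degree 3 takes 6 out of the degree sum and the edge `ab` restores 2. The loss of
  -- 4 is exactly what the bound drops with one vertex.
  total-G′ : total G ≡ total G′ + 4
  total-G′ = begin
    total G                                                      ≡⟨ total-restrict G ⟩
    deg G zero + deg G zero + total (restrict G)                 ≡⟨ cong (λ k → k + k + total (restrict G)) deg-zero≡3 ⟩
    6 + total (restrict G)                                       ≡⟨ shuffle (total (restrict G)) ⟩
    total (restrict G) + (1 + 1) + 4                             ≡⟨ cong (λ k → total (restrict G) + k + 4) (cong₂ _+_ (sum-δ a) (sum-δ b)) ⟨
    total (restrict G) + (sum (δ a) + sum (δ b)) + 4             ≡⟨ cong (λ k → total (restrict G) + k + 4) (∑-distrib-+ (δ a) (δ b)) ⟨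
    total (restrict G) + sum (λ i → δ a i + δ b i) + 4           ≡⟨ cong (_+ 4) (∑-distrib-+ (deg (restrict G)) _) ⟨
    sum (λ i → deg (restrict G) i + (δ a i + δ b i)) + 4         ≡⟨ cong (_+ 4) (sum-cong-≗ (deg-addEdge (restrict G) a≢b ab)) ⟨
    total G′ + 4                                                 ∎
    where
    open ≡.≡-Reasoning
    shuffle : ∀ t → 6 + t ≡ t + (1 + 1) + 4
    shuffle = solve-∀

  -- `a` and `b` exchange their edge to `zero` for the edge `ab`; only `c` loses a degree.
  deg-G′ : ∀ i → deg G (suc i) ≡ deg G′ i + δ c i
  deg-G′ i = begin
    deg G (suc i)                                       ≡⟨ deg-suc G i ⟩
    ι (nbr G i) + deg (restrict G) i                    ≡⟨ cong (_+ deg (restrict G) i) (indicator row i) ⟩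
    δ a i + (δ b i + δ c i) + deg (restrict G) i        ≡⟨ shuffle (δ a i) (δ b i) (δ c i) _ ⟩
    deg (restrict G) i + (δ a i + δ b i) + δ c i        ≡⟨ cong (_+ δ c i) (deg-addEdge (restrict G) a≢b ab i) ⟨
    deg G′ i + δ c i                                    ∎
    where
    open ≡.≡-Reasoning
    shuffle : ∀ a b c d → a + (b + c) + d ≡ d + (a + b) + c
    shuffle = solve-∀

  -- `C₂` misses `uw`, so it survives the removal of that edge and reaches `zero` from `c`, while
  -- `C₁` reaches it from `u` and `w`. As `c` differs from both, the new edges are not shared.
  pinch : (H C₁ C₂ : SimpleGraph n) → (∀ i → deg H i ≡ deg G′ i) → Subgraph C₁ H → Subgraph C₂ H →
    Connected C₁ → Connected C₂ → Share s C₁ C₂ →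
    ∀ {u w} → adj H u w ≡ true → u ≢ c → w ≢ c → adj C₂ u w ≡ false → Packs s (deg G)
  pinch H C₁ C₂ r s₁ s₂ c₁ c₂ sh {u} {w} e u≢c w≢c f =
    extend H⁻ (three u w c) , degrees , extend C₁⁻ (λ j → (u == j) ∨ (w == j)) , extend C₂ (c ==_) ,
    subgraph-extend {C = C₁⁻} {H⁻} (removeEdge-mono {C = C₁} {H} u≢w s₁) into-three ,
    subgraph-extend {C = C₂} {H⁻} (subgraph-avoiding {C = C₂} {H} u≢w f s₂) (λ j p → ∨-introʳ {u == j} (∨-introʳ {w == j} p)) ,
    connected-subdivide C₁ _ u≢w (∨-introˡ (==-refl u)) (∨-introʳ {u == w} (==-refl w)) c₁ ,
    connected-pendant C₂ (c ==_) (==-refl c) c₂ ,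
    share-extend {C₁ = C₁⁻} {C₂} disjoint (share-sub {C₁ = C₁} {C₂} {C₁⁻} {C₂} (subgraph-removeEdge C₁ u≢w) (λ _ _ p → p) sh)
    where
    open ≡.≡-Reasoning
    u≢w = adj-≢ H e
    H⁻  = removeEdge H u w u≢w
    C₁⁻ = removeEdge C₁ u w u≢w
    into-three : ∀ j → (u == j) ∨ (w == j) ≡ true → three u w c j ≡ true
    into-three j p with ∨-elim {u == j} p
    ... | inj₁ q = ∨-introˡ q
    ... | inj₂ q = ∨-introʳ {u == j} (∨-introˡ q)
    disjoint : ∀ j → (u == j) ∨ (w == j) ≡ true → (c == j) ≡ true → ⊥
    disjoint j p q with ∨-elim {u == j} p
    ... | inj₁ p′ = u≢c (trans (==-sound p′) (≡.sym (==-sound q)))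
    ... | inj₂ p′ = w≢c (trans (==-sound p′) (≡.sym (==-sound q)))
    row′ : Row₃ (three u w c) u w c
    row′ = row₃-three u≢w u≢c w≢c
    degrees : ∀ i → deg (extend H⁻ (three u w c)) i ≡ deg G i
    degrees zero    = trans (row₃-size row′) (≡.sym deg-zero≡3)
    degrees (suc i) = begin
      ι (three u w c i) + deg H⁻ i                 ≡⟨ cong (_+ deg H⁻ i) (indicator row′ i) ⟩
      δ u i + (δ w i + δ c i) + deg H⁻ i           ≡⟨ shuffle (δ u i) (δ w i) (δ c i) _ ⟩
      deg H⁻ i + (δ u i + δ w i) + δ c i           ≡⟨ cong (_+ δ c i) (deg-removeEdge H u≢w e i) ⟨
      deg H i + δ c i                              ≡⟨ cong (_+ δ c i) (r i) ⟩
      deg G′ i + δ c i                             ≡⟨ deg-G′ i ⟨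
      deg G (suc i)                                ∎
      where
      shuffle : ∀ a b c d → a + (b + c) + d ≡ d + (a + b) + c
      shuffle = solve-∀

  -- `a` keeps its degree in `H`, so at least two edges of `H` at `a` avoid `c`, and one of them is
  -- not shared. If `C₁` is the subgraph that misses it, the two subgraphs change roles.
  packs-pinch : 3 ≤ deg G (suc a) → Packs s (deg G′) → Packs s (deg G)
  packs-pinch 3≤d (H , r , C₁ , C₂ , s₁ , s₂ , c₁ , c₂ , sh) = use (pick₂ (without (adj H a) c) enough)
    where
    cover : ∀ j → ι (adj H a j) ≤ δ c j + ι (without (adj H a) c j)
    cover j with c ≟ j | adj H a j
    ... | yes _ | true  = ≤-refl
    ... | yes _ | false = z≤n
    ... | no _  | true  = ≤-refl
    ... | no _  | false = z≤n
    enough : 2 ≤ sum (ι ∘ without (adj H a) c)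
    enough = ≤-pred (begin
      3                                                ≤⟨ 3≤d ⟩
      deg G (suc a)                                    ≡⟨ deg-G′ a ⟩
      deg G′ a + δ c a                                 ≡⟨ cong₂ _+_ (≡.sym (r a)) (cong ι (==-≢ (a≢c ∘ ≡.sym))) ⟩
      deg H a + 0                                      ≡⟨ +-identityʳ _ ⟩
      deg H a                                          ≤⟨ sum-mono cover ⟩
      sum (λ j → δ c j + ι (without (adj H a) c j))    ≡⟨ ∑-distrib-+ (δ c) _ ⟩
      sum (δ c) + sum (ι ∘ without (adj H a) c)        ≡⟨ cong (_+ sum (ι ∘ without (adj H a) c)) (sum-δ c) ⟩
      suc (sum (ι ∘ without (adj H a) c))              ∎)
      where open ≤-Reasoning
    along : ∀ {z} → without (adj H a) c z ≡ true → adj C₁ a z ≡ false ⊎ adj C₂ a z ≡ false → Packs s (deg G)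
    along h (inj₁ f) = pinch H C₂ C₁ r s₂ s₁ c₂ c₁ (share-swap {C₁ = C₁} {C₂} sh) (∧-elimˡ h) a≢c (without-≢ (adj H a) h ∘ ≡.sym) f
    along h (inj₂ f) = pinch H C₁ C₂ r s₁ s₂ c₁ c₂ sh (∧-elimˡ h) a≢c (without-≢ (adj H a) h ∘ ≡.sym) f
    use : ∃[ x ] ∃[ y ] (without (adj H a) c x ≡ true × without (adj H a) c y ≡ true × x ≢ y) → Packs s (deg G)
    use (x , y , hx , hy , x≢y) = Data.Sum.[ along hx , along hy ] (unshared-edge C₁ C₂ sh a x≢y)

-- Blocked triangles and discharging

-- No 2-switch replaces pq and an edge wy outside r by py and qw.
Blocked : SimpleGraph n → (Fin n → Bool) → Fin n → Fin n → Set
Blocked R r p q = ∀ w y → r w ≡ false → r y ≡ false → adj R w y ≡ true → adj R w q ≡ false → adj R y p ≡ true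

-- The contrapositive of the condition, read along the edge `yw` instead of `wy`.
blocked-sym : (R : SimpleGraph n) (r : Fin n → Bool) {p q : Fin n} → Blocked R r p q → Blocked R r q p
blocked-sym R r {p} {q} bl w y rw ry wy wp with adj R y q in e
... | true  = refl
... | false = ⊥-elim (true≢false (bl y w ry rw (adj-sym R wy) e) wp)

not-true : ∀ {b} → not b ≡ true → b ≡ false
not-true {false} _ = refl

break-or-blocked : (R : SimpleGraph n) (r : Fin n → Bool) {p q : Fin n} → r p ≡ true → r q ≡ true → adj R p q ≡ true →
  (∃[ R′ ] ((∀ i → deg R′ i ≡ deg R i) × adj R′ p q ≡ false)) ⊎ Blocked R r p q
break-or-blocked R r {p} {q} rp rq pq with any? (λ w → any? (λ y → (adj R w y ∧ not (r w) ∧ not (r y) ∧ not (adj R y p) ∧ not (adj R w q)) ≟ᵇ true))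
... | yes (w , y , e) = inj₁ (switch , deg-switch , switch-ab)
  where
  e₁ = ∧-elimʳ {adj R w y} e
  e₂ = ∧-elimʳ {not (r w)} e₁
  e₃ = ∧-elimʳ {not (r y)} e₂
  e₄ = ∧-elimʳ {not (adj R y p)} e₃
  p≢y : p ≢ y
  p≢y refl = true≢false rp (not-true (∧-elimˡ e₂))
  q≢w : q ≢ w
  q≢w refl = true≢false rq (not-true (∧-elimˡ e₁))
  -- The switch trades `pq`, `yw` for `py`, `qw`. Since `r` holds at `p`, `q` and fails at `w`, `y`,
  -- the required inequalities hold.
  open Switch R {p} {q} {y} {w} pq (adj-sym R (∧-elimˡ e)) (adj-sym R (not-true (∧-elimˡ e₃))) (adj-sym R (not-true e₄)) p≢y q≢w
... | no none = inj₂ blocked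
  where
  blocked : Blocked R r p q
  blocked w y rw ry wy wq with adj R y p in yp
  ... | true  = refl
  ... | false = contradiction (w , y , test) none
    where
    test : (adj R w y ∧ not (r w) ∧ not (r y) ∧ not (adj R y p) ∧ not (adj R w q)) ≡ true
    test rewrite wy | rw | ry | yp | wq = refl

-- Let k x be the number of neighbours of x on the triangle abc.  A vertex on
-- the triangle starts with charge k x, any other one with deg x + k x; the
-- charges add up to the degree sum.  Each hub (k = 3) off the triangle passes
-- one unit to each of its neighbours off the triangle.  By the blocking
-- hypotheses all such neighbours of a vertex with k ≤ 1 are hubs, so every
-- vertex off the triangle ends up with at least 5.
module Discharging (R : SimpleGraph n) (r : Fin n → Bool) {a b c : Fin n} (row : Row₃ r a b c)
  (ab : adj R a b ≡ true) (bc : adj R b c ≡ true) (ca : adj R c a ≡ true)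
  (3≤deg : ∀ w → r w ≡ false → 3 ≤ deg R w)
  (bl-ab : Blocked R r a b) (bl-bc : Blocked R r b c) (bl-ca : Blocked R r c a) where

  k : Fin n → ℕ
  k x = ι (adj R x a) + (ι (adj R x b) + ι (adj R x c))

  hub : Fin n → Bool
  hub x = adj R x a ∧ adj R x b ∧ adj R x c

  pass : Fin n → Fin n → ℕ
  pass x y = ι (not (r x) ∧ hub x ∧ not (r y) ∧ adj R x y)

  off : Fin n → ℕ
  off x = if r x then 0 else deg R x

  -- `final` is the charge that must remain after passing: triangle vertices have at least 2 from
  -- each other and pass nothing.
  received given final : Fin n → ℕ
  received x = sum (λ y → pass y x)
  given x    = sum (pass x)
  final x    = if r x then 2 else 5

  sum-k : sum k ≡ sum (λ x → ι (r x) · deg R x)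
  sum-k = begin
    sum k                                                                              ≡⟨ ∑-distrib-+ (λ x → ι (adj R x a)) _ ⟩
    sum (λ x → ι (adj R x a)) + sum (λ x → ι (adj R x b) + ι (adj R x c))              ≡⟨ cong (sum (λ x → ι (adj R x a)) +_) (∑-distrib-+ (λ x → ι (adj R x b)) _) ⟩
    sum (λ x → ι (adj R x a)) + (sum (λ x → ι (adj R x b)) + sum (λ x → ι (adj R x c))) ≡⟨ cong₂ _+_ (column a) (cong₂ _+_ (column b) (column c)) ⟩
    deg R a + (deg R b + deg R c)                                                      ≡⟨ row₃-sum row (deg R) ⟨
    sum (λ x → ι (r x) · deg R x)                                                      ∎
    where
    open ≡.≡-Reasoning
    column : ∀ y → sum (λ x → ι (adj R x y)) ≡ deg R y
    column y = sum-cong-≗ (λ x → cong ι (sym R x y))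

  total-charge : sum (λ x → off x + k x) ≡ total R
  total-charge = begin
    sum (λ x → off x + k x)                      ≡⟨ ∑-distrib-+ off k ⟩
    sum off + sum k                              ≡⟨ cong (sum off +_) sum-k ⟩
    sum off + sum (λ x → ι (r x) · deg R x)      ≡⟨ ∑-distrib-+ off _ ⟨
    sum (λ x → off x + ι (r x) · deg R x)        ≡⟨ sum-cong-≗ pointwise ⟩
    total R                                      ∎
    where
    open ≡.≡-Reasoning
    pointwise : ∀ x → off x + ι (r x) · deg R x ≡ deg R x
    pointwise x with r x
    ... | true  = +-identityʳ _
    ... | false = +-identityʳ _

  no-pass : ∀ x → not (r x) ∧ hub x ≡ false → given x ≡ 0
  no-pass x e = sum-zero λ y → cong ι (drop (not (r x)) (hub x) (not (r y) ∧ adj R x y) e)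
    where
    drop : ∀ u v w → u ∧ v ≡ false → u ∧ v ∧ w ≡ false
    drop true  false _ _ = refl
    drop false _     _ _ = refl

  on-triangle : ∀ x → r x ≡ true → 2 ≤ k x
  on-triangle x rx with row₃-member row x rx
  ... | inj₁ refl        rewrite irrfl R a | ab | adj-sym R ca = ≤-refl
  ... | inj₂ (inj₁ refl) rewrite irrfl R b | adj-sym R ab | bc = ≤-refl
  ... | inj₂ (inj₂ refl) rewrite irrfl R c | adj-sym R bc | ca = ≤-refl

  -- Three edges of a hub lead to the triangle; it passes at most one unit along each of the others.
  hub-charge : ∀ x → r x ≡ false → adj R x a ≡ true → adj R x b ≡ true → adj R x c ≡ true → given x + 3 ≤ deg R x
  hub-charge x rx xa xb xc = begin
    given x + 3                     ≡⟨ cong (given x +_) (row₃-size row) ⟨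
    given x + sum (ι ∘ r)           ≡⟨ ∑-distrib-+ (pass x) (ι ∘ r) ⟨
    sum (λ y → pass x y + ι (r y))  ≤⟨ sum-mono pointwise ⟩
    deg R x                         ∎
    where
    open ≤-Reasoning
    pointwise : ∀ y → pass x y + ι (r y) ≤ ι (adj R x y)
    pointwise y with r y in ry
    ... | false rewrite rx | xa | xb | xc = ≤-reflexive (+-identityʳ _)
    ... | true rewrite rx | xa | xb | xc with row₃-member row y ry
    ...   | inj₁ refl        rewrite xa = ≤-refl
    ...   | inj₂ (inj₁ refl) rewrite xb = ≤-refl
    ...   | inj₂ (inj₂ refl) rewrite xc = ≤-refl

  AllHubs : Fin n → Set
  AllHubs x = ∀ y → r y ≡ false → adj R x y ≡ true → adj R y a ≡ true × adj R y b ≡ true × adj R y c ≡ true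

  -- An edge at `x` leads either to the triangle, where `k x` counts it, or to a hub, which passes a
  -- unit back along it.
  poor-charge : ∀ x → r x ≡ false → AllHubs x → deg R x ≤ received x + k x
  poor-charge x rx hubs = begin
    deg R x                                                ≤⟨ sum-mono pointwise ⟩
    sum (λ y → pass y x + ι (r y) · ι (adj R x y))         ≡⟨ ∑-distrib-+ (λ y → pass y x) _ ⟩
    received x + sum (λ y → ι (r y) · ι (adj R x y))       ≡⟨ cong (received x +_) (row₃-sum row (ι ∘ adj R x)) ⟩
    received x + k x                                       ∎
    where
    open ≤-Reasoning
    pointwise : ∀ y → ι (adj R x y) ≤ pass y x + ι (r y) · ι (adj R x y)
    pointwise y with r y in ry
    ... | true  = ≤-reflexive (≡.sym (+-identityʳ _))
    ... | false with adj R x y in xy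
    ...   | false = z≤n
    ...   | true with hubs y ry xy
    ...     | ya , yb , yc rewrite rx | ya | yb | yc | adj-sym R xy = ≤-refl

  -- If `x` misses a triangle vertex, the two blocked pairs containing that vertex make `y` adjacent
  -- to the other two. Two missing vertices therefore give all three adjacencies.
  hubs-ab : ∀ x → r x ≡ false → adj R x a ≡ false → adj R x b ≡ false → AllHubs x
  hubs-ab x rx xa xb y ry xy = bl-ab x y rx ry xy xb , blocked-sym R r bl-ab x y rx ry xy xa , bl-ca x y rx ry xy xa

  hubs-bc : ∀ x → r x ≡ false → adj R x b ≡ false → adj R x c ≡ false → AllHubs x
  hubs-bc x rx xb xc y ry xy = bl-ab x y rx ry xy xb , bl-bc x y rx ry xy xc , blocked-sym R r bl-bc x y rx ry xy xb

  hubs-ca : ∀ x → r x ≡ false → adj R x c ≡ false → adj R x a ≡ false → AllHubs x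
  hubs-ca x rx xc xa y ry xy = blocked-sym R r bl-ca x y rx ry xy xc , bl-bc x y rx ry xy xc , bl-ca x y rx ry xy xa

  -- For `k x = 3` the degree is at least `given x + 3`, leaving 6. For `k x = 2` nothing is given
  -- and 3 + 2 remains. For `k x ≤ 1` the terms `k x + received x` again reach the degree, so the
  -- total is at least 3 + 3.
  off-triangle : ∀ x → r x ≡ false → 5 + given x ≤ deg R x + k x + received x
  off-triangle x rx = by-cases (adj R x a) (adj R x b) (adj R x c) refl refl refl
    where
    not-hub : hub x ≡ false → given x ≡ 0
    not-hub h = no-pass x (trans (cong (not (r x) ∧_) h) (∧-zeroʳ (not (r x))))
    rich : k x ≡ 3 → given x + 3 ≤ deg R x → 5 + given x ≤ deg R x + k x + received x
    rich kx h rewrite kx = ≤-trans (≤-from (5 + given x) (deg R x + 3) 1 h (eq (given x) (deg R x))) (m≤m+n _ _)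
      where
      eq : ∀ g d → 5 + g + d + 1 ≡ d + 3 + (g + 3)
      eq = solve-∀
    two : hub x ≡ false → k x ≡ 2 → 5 + given x ≤ deg R x + k x + received x
    two h kx rewrite not-hub h | kx = ≤-trans (+-monoˡ-≤ 2 (3≤deg x rx)) (m≤m+n _ _)
    poor : hub x ≡ false → AllHubs x → 5 + given x ≤ deg R x + k x + received x
    poor h hubs rewrite not-hub h = ≤-from 5 _ 1 (+-mono-≤ (poor-charge x rx hubs) (+-mono-≤ (3≤deg x rx) (3≤deg x rx))) (eq (deg R x) (k x) (received x))
      where
      eq : ∀ d k r → 5 + (r + k + (d + d)) + 1 ≡ d + k + r + (d + (3 + 3))
      eq = solve-∀
    hub-is : ∀ {u v w} → adj R x a ≡ u → adj R x b ≡ v → adj R x c ≡ w → hub x ≡ u ∧ v ∧ w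
    hub-is refl refl refl = refl
    k-is : ∀ {u v w} → adj R x a ≡ u → adj R x b ≡ v → adj R x c ≡ w → k x ≡ ι u + (ι v + ι w)
    k-is refl refl refl = refl
    by-cases : ∀ u v w → adj R x a ≡ u → adj R x b ≡ v → adj R x c ≡ w → 5 + given x ≤ deg R x + k x + received x
    by-cases true  true  true  p q s = rich (k-is p q s) (hub-charge x rx p q s)
    by-cases true  true  false p q s = two (hub-is p q s) (k-is p q s)
    by-cases true  false true  p q s = two (hub-is p q s) (k-is p q s)
    by-cases false true  true  p q s = two (hub-is p q s) (k-is p q s)
    by-cases true  false false p q s = poor (hub-is p q s) (hubs-bc x rx q s)
    by-cases false true  false p q s = poor (hub-is p q s) (hubs-ca x rx s p)
    by-cases false false w     p q s = poor (hub-is p q s) (hubs-ab x rx p q)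

  final-charge : ∀ x → final x + given x ≤ off x + k x + received x
  final-charge x = by-case (r x) refl
    where
    by-case : ∀ u → r x ≡ u → final x + given x ≤ off x + k x + received x
    by-case false rx = subst (λ u → (if u then 2 else 5) + given x ≤ (if u then 0 else deg R x) + k x + received x) (≡.sym rx) (off-triangle x rx)
    by-case true  rx rewrite no-pass x (cong (λ u → not u ∧ hub x) rx) | rx = ≤-trans (on-triangle x rx) (m≤m+n _ _)

  -- Passing conserves charge. The constant 9 is the shortfall of the three triangle vertices, which
  -- are guaranteed 2 instead of 5.
  total-bound : n · 5 ≤ total R + 9
  total-bound = ≤-from (n · 5) (total R + 9) 0 summed (eq (n · 5) (sum final) (sum given) (total R) 9 split)
    where
    open ≡.≡-Reasoning
    exchange : sum received ≡ sum given
    exchange = ∑-comm (λ x y → pass y x)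
    split : sum final + 9 ≡ n · 5
    split = begin
      sum final + 9                          ≡⟨ cong (λ z → sum final + 3 · z) (row₃-size row) ⟨
      sum final + 3 · sum (ι ∘ r)            ≡⟨ cong (sum final +_) (sum-·ˡ 3 (ι ∘ r)) ⟨
      sum final + sum (λ x → 3 · ι (r x))    ≡⟨ ∑-distrib-+ final _ ⟨
      sum (λ x → final x + 3 · ι (r x))      ≡⟨ sum-cong-≗ pointwise ⟩
      sum {n} (λ _ → 5)                      ≡⟨ sum-const n 5 ⟩
      n · 5                                  ∎
      where
      pointwise : ∀ x → final x + 3 · ι (r x) ≡ 5
      pointwise x with r x
      ... | true  = refl
      ... | false = refl
    summed : sum final + sum given ≤ total R + sum given
    summed = ≤-trans (≤-reflexive (≡.sym (∑-distrib-+ final given))) (≤-trans (sum-mono final-charge)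
      (≤-reflexive (trans (∑-distrib-+ (λ x → off x + k x) received) (cong₂ _+_ total-charge exchange))))
    eq : ∀ N f g t e → f + e ≡ N → N + (t + g) + 0 ≡ t + e + (f + g)
    eq N f g t e refl = shuffle f e t g
      where
      shuffle : ∀ f e t g → f + e + (t + g) + 0 ≡ t + e + (f + g)
      shuffle = solve-∀

-- Giving a vertex neighbours of degree at least 3

exchange-neighbour : (G : SimpleGraph n) {v x y : Fin n} → adj G v x ≡ true → v ≢ y → adj G v y ≡ false → deg G x < deg G y →
  ∃[ G′ ] ((∀ i → deg G′ i ≡ deg G i) × adj G′ v x ≡ false × adj G′ v y ≡ true × (∀ j → x ≢ j → y ≢ j → adj G′ v j ≡ adj G v j))
exchange-neighbour G {v} {x} {y} vx v≢y vy dx<dy with any? (λ z → (adj G y z ∧ not (adj G x z) ∧ not (x == z)) ≟ᵇ true)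
-- `z` is a neighbour of `y` that is neither `x` nor adjacent to `x`; the switch trades `vx`, `yz`
-- for `vy`, `xz`.
... | yes (z , e) = switch , deg-switch , switch-ab , switch-ax , switch-a
  where
  e₁ = ∧-elimʳ {adj G y z} e
  x≢z : x ≢ z
  x≢z = without-≢ (not ∘ adj G x) e₁
  open Switch G vx (∧-elimˡ e) vy (not-true (∧-elimˡ e₁)) v≢y x≢z
... | no none = contradiction (+-cancelʳ-≤ (ι (adj G x y)) _ _ bound) (<⇒≱ dx<dy)
  where
  x≢y : x ≢ y
  x≢y refl = true≢false vx vy
  -- Without such a `z`, row `y` lies below row `x` except possibly at `x` and `y`. There the added
  -- terms replace the zero diagonal entry by the adjacency of `x` and `y`.
  pointwise : ∀ j → ι (adj G y j) + δ y j · ι (adj G x y) ≤ ι (adj G x j) + δ x j · ι (adj G x y)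
  pointwise j with y ≟ j | x ≟ j
  ... | yes refl | yes refl = contradiction refl x≢y
  ... | yes refl | no _ rewrite irrfl G y = ≤-refl
  ... | no _ | yes refl rewrite irrfl G x | sym G y x | +-identityʳ (ι (adj G x y)) = ≤-refl
  ... | no _ | no x≢j with adj G y j in yj | adj G x j in xj
  ...   | false | _    = z≤n
  ...   | true | true  = ≤-refl
  ...   | true | false = contradiction (j , test) none
    where
    test : adj G y j ∧ not (adj G x j) ∧ not (x == j) ≡ true
    test rewrite yj | xj | ==-≢ x≢j = refl
  bound : deg G y + ι (adj G x y) ≤ deg G x + ι (adj G x y)
  bound = begin
    deg G y + ι (adj G x y)                             ≡⟨ cong (deg G y +_) (sum-pick y (λ _ → ι (adj G x y))) ⟨
    deg G y + sum (λ j → δ y j · ι (adj G x y))         ≡⟨ ∑-distrib-+ (ι ∘ adj G y) _ ⟨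
    sum (λ j → ι (adj G y j) + δ y j · ι (adj G x y))   ≤⟨ sum-mono pointwise ⟩
    sum (λ j → ι (adj G x j) + δ x j · ι (adj G x y))   ≡⟨ ∑-distrib-+ (ι ∘ adj G x) _ ⟩
    deg G x + sum (λ j → δ x j · ι (adj G x y))         ≡⟨ cong (deg G x +_) (sum-pick x (λ _ → ι (adj G x y))) ⟩
    deg G x + ι (adj G x y)                             ∎
    where open ≤-Reasoning

without-keep : (f : Fin n → Bool) {x y : Fin n} → f y ≡ true → x ≢ y → without f x y ≡ true
without-keep f fy x≢y rewrite fy | ==-≢ x≢y = refl

does-sound : {A : Set} (A? : Dec A) → does A? ≡ true → A
does-sound (yes a) _ = a

three-true : (f : Fin n → Bool) {x y z : Fin n} → f x ≡ true → f y ≡ true → f z ≡ true → x ≢ y → x ≢ z → y ≢ z → 3 ≤ sum (ι ∘ f)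
three-true f {x} {y} {z} fx fy fz x≢y x≢z y≢z
  rewrite sum-without f x fx | sum-without (without f x) y (without-keep f fy x≢y) =
  s≤s (s≤s (≤-trans (≤-reflexive (cong ι (≡.sym gz))) (sum-≥ (ι ∘ without (without f x) y) z)))
  where
  gz : without (without f x) y z ≡ true
  gz = without-keep (without f x) (without-keep f fz x≢z) y≢z

Improved : SimpleGraph n → Fin n → Set
Improved G v = ∃[ G′ ] ((∀ i → deg G′ i ≡ deg G i) × (∀ j → adj G′ v j ≡ true → 3 ≤ deg G j))

-- The hypothesis `strong` says that at least two vertices have degree at least 3.
module Improve (G : SimpleGraph n) (v : Fin n) (dv≤2 : deg G v ≤ 2) (strong : ∀ z → ∃[ y ] (z ≢ y × 3 ≤ deg G y)) where

  weak : Fin n → Bool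
  weak j = does (deg G j ≤? 2)

  weak-sound : ∀ {j} → weak j ≡ true → deg G j ≤ 2
  weak-sound {j} = does-sound (deg G j ≤? 2)

  weak-complete : ∀ {j} → 3 ≤ deg G j → weak j ≡ false
  weak-complete {j} p = dec-false (deg G j ≤? 2) (<⇒≱ p)

  -- If `v` has a second neighbour `z`, a strong vertex other than `z` cannot be adjacent to `v`, as
  -- it would be a third neighbour. If `x` is the only neighbour, any strong vertex will do.
  replacement : (G′ : SimpleGraph n) → (∀ i → deg G′ i ≡ deg G i) → ∀ {x} → adj G′ v x ≡ true → deg G x ≤ 2 →
    ∃[ y ] (v ≢ y × adj G′ v y ≡ false × 3 ≤ deg G y)
  replacement G′ same {x} vx dx≤2 with any? (λ z → without (adj G′ v) x z ≟ᵇ true)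
  ... | yes (z , e) with strong z
  ...   | y , z≢y , 3≤dy = y , (λ { refl → <⇒≱ 3≤dy dv≤2 }) , absent , 3≤dy
    where
    absent : adj G′ v y ≡ false
    absent with adj G′ v y in vy
    ... | false = refl
    ... | true  = contradiction (≤-trans (three-true (adj G′ v) vx (∧-elimˡ e) vy (without-≢ (adj G′ v) e) (λ { refl → <⇒≱ 3≤dy dx≤2 }) z≢y) (≤-reflexive (same v))) (<⇒≱ (s≤s dv≤2))
  replacement G′ same {x} vx dx≤2 | no none with strong x
  ...   | y , x≢y , 3≤dy = y , (λ { refl → <⇒≱ 3≤dy dv≤2 }) , absent , 3≤dy
    where
    absent : adj G′ v y ≡ false
    absent with adj G′ v y in vy
    ... | false = refl
    ... | true  = contradiction (y , cong₂ _∧_ vy (cong not (==-≢ x≢y))) none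

  -- Induction on a bound for the number of weak neighbours of `v`: each exchange replaces one of
  -- them by a strong vertex.
  improve-from : ∀ k (G′ : SimpleGraph n) → (∀ i → deg G′ i ≡ deg G i) → sum (λ j → ι (adj G′ v j ∧ weak j)) ≤ k → Improved G v
  improve-from k G′ same few with any? (λ j → (adj G′ v j ∧ weak j) ≟ᵇ true)
  ... | no none = G′ , same , λ j vj → ≰⇒> λ dj≤2 → none (j , trans (cong (_∧ weak j) vj) (dec-true (deg G j ≤? 2) dj≤2))
  improve-from zero G′ same few | yes (x , e) =
    contradiction (≤-trans (≤-reflexive (cong ι (≡.sym e))) (≤-trans (sum-≥ (λ j → ι (adj G′ v j ∧ weak j)) x) few)) λ ()
  improve-from (suc k) G′ same few | yes (x , e) with replacement G′ same (∧-elimˡ e) (weak-sound (∧-elimʳ {adj G′ v x} e))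
  ... | y , v≢y , vy , 3≤dy with exchange-neighbour G′ {v} {x} {y} (∧-elimˡ e) v≢y vy
        (≡.subst₂ _<_ (≡.sym (same x)) (≡.sym (same y)) (≤-trans (s≤s (weak-sound (∧-elimʳ {adj G′ v x} e))) 3≤dy))
  ...   | G″ , same′ , vx″ , vy″ , other = improve-from k G″ (λ i → trans (same′ i) (same i)) (≤-pred (≤-trans (≤-reflexive (≡.sym fewer)) few))
    where
    pointwise : ∀ j → ι (adj G′ v j ∧ weak j) ≡ δ x j + ι (adj G″ v j ∧ weak j)
    pointwise j with x ≟ j | y ≟ j
    ... | yes refl | _ rewrite e | vx″ = refl
    ... | no _ | yes refl rewrite vy | vy″ | weak-complete 3≤dy = refl
    ... | no p | no q rewrite other j p q = refl
    fewer : sum (λ j → ι (adj G′ v j ∧ weak j)) ≡ suc (sum (λ j → ι (adj G″ v j ∧ weak j)))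
    fewer = trans (sum-cong-≗ pointwise) (trans (∑-distrib-+ (δ x) _) (cong (_+ sum (λ j → ι (adj G″ v j ∧ weak j))) (sum-δ x)))

  improve : Improved G v
  improve = improve-from _ G (λ _ → refl) ≤-refl

-- Otherwise all vertices but `z` have degree at most 2, and the degree sum is at most `2 · m + m`,
-- which is below `4 · m - 2` once `m ≥ 3`.
two-strong : (G : SimpleGraph (suc m)) → 3 ≤ m → 4 · m ≤ total G + 2 → ∀ z → ∃[ y ] (z ≢ y × 3 ≤ deg G y)
two-strong {m} G 3≤m big z with any? (λ y → ¬? (z ≟ y) ×-dec (3 ≤? deg G y))
... | yes p = p
... | no none = absurd-from 0 (+-mono-≤ 3≤m (≤-trans big bound)) (eq m)
  where
  pointwise : ∀ y → deg G y + δ z y · 2 ≤ 2 + δ z y · m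
  pointwise y with z ≟ y
  ... | yes refl rewrite +-identityʳ m | +-comm (deg G z) 2 = s≤s (s≤s (deg≤ G z))
  ... | no z≢y rewrite +-identityʳ (deg G y) = ≤-pred (≰⇒> λ p → none (y , z≢y , p))
  bound : total G + 2 ≤ suc m · 2 + m
  bound = begin
    total G + 2                               ≡⟨ cong (total G +_) (sum-pick z (λ _ → 2)) ⟨
    total G + sum (λ y → δ z y · 2)           ≡⟨ ∑-distrib-+ (deg G) (λ y → δ z y · 2) ⟨
    sum (λ y → deg G y + δ z y · 2)           ≤⟨ sum-mono pointwise ⟩
    sum (λ y → 2 + δ z y · m)                 ≡⟨ ∑-distrib-+ {suc m} (λ _ → 2) (λ y → δ z y · m) ⟩
    sum {suc m} (λ _ → 2) + sum (λ y → δ z y · m) ≡⟨ cong₂ _+_ (sum-const (suc m) 2) (sum-pick z (λ _ → m)) ⟩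
    suc m · 2 + m                             ∎
    where open ≤-Reasoning
  eq : ∀ m → suc (m + (suc m · 2 + m) + 0) ≡ 3 + 4 · m
  eq = solve-∀

-- The small graphs K₂ and K₄

complete : (G : SimpleGraph (suc m)) {i : Fin (suc m)} → m ≤ deg G i → ∀ {j} → i ≢ j → adj G i j ≡ true
complete {m} G {i} m≤d {j} i≢j with adj G i j in ij
... | true  = refl
-- A missing edge at `i` could be added, raising the degree of `i` above `m`.
... | false = contradiction (≤-trans (s≤s m≤d) (≤-trans (≤-reflexive (≡.sym grow)) (deg≤ (addEdge G i j i≢j) i))) 1+n≰n
  where
  grow : deg (addEdge G i j i≢j) i ≡ suc (deg G i)
  grow rewrite deg-addEdge G i≢j ij i | ==-refl i | ==-≢ (i≢j ∘ ≡.sym) = +-comm (deg G i) 1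

packs-K₂ : (G : SimpleGraph 2) → adj G zero (suc zero) ≡ true → Packs true (deg G)
packs-K₂ G e = G , (λ _ → refl) , G , G , (λ _ _ p → p) , (λ _ _ p → p) , conn , conn , λ i j k l p q → refl , same i j k l (adj-≢ G (proj₁ p)) (adj-≢ G (proj₁ q))
  where
  conn : Connected G
  conn = connected-from G zero λ { zero → here ; (suc zero) → step (adj-sym G e) here }
  same : (i j k l : Fin 2) → i ≢ j → k ≢ l → SameEdge i j k l
  same zero       zero       _          _          p _ = contradiction refl p
  same (suc zero) (suc zero) _          _          p _ = contradiction refl p
  same zero       (suc zero) zero       zero       _ q = contradiction refl q
  same zero       (suc zero) (suc zero) (suc zero) _ q = contradiction refl q
  same (suc zero) zero       zero       zero       _ q = contradiction refl q
  same (suc zero) zero       (suc zero) (suc zero) _ q = contradiction refl q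
  same zero       (suc zero) zero       (suc zero) _ _ = inj₁ (refl , refl)
  same zero       (suc zero) (suc zero) zero       _ _ = inj₂ (refl , refl)
  same (suc zero) zero       zero       (suc zero) _ _ = inj₂ (refl , refl)
  same (suc zero) zero       (suc zero) zero       _ _ = inj₁ (refl , refl)

edgeless : SimpleGraph n
edgeless .adj _ _ = false
edgeless .sym _ _ = refl
edgeless .irrfl _ = refl

complement : SimpleGraph n → SimpleGraph n
complement G .adj i j = not (i == j) ∧ not (adj G i j)
complement G .sym i j rewrite ==-sym i j | sym G i j = refl
complement G .irrfl i rewrite ==-refl i = refl

P₄ : SimpleGraph 4
P₄ = extend (extend (extend edgeless (zero ==_)) (zero ==_)) (zero ==_)

-- K₄ splits into a Hamiltonian path and its complement, again a path.
packs-K₄ : ∀ {s} (G : SimpleGraph 4) → (∀ i → 3 ≤ deg G i) → Packs s (deg G)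
packs-K₄ G 3≤d = G , (λ _ → refl) , P₄ , complement P₄ ,
  (λ i j p → complete G (3≤d i) (adj-≢ P₄ p)) , (λ i j p → complete G (3≤d i) (adj-≢ (complement P₄) p)) ,
  connected-from P₄ zero (λ
    { zero                   → here
    ; (suc zero)             → step {v = zero} refl here
    ; (suc (suc zero))       → step {v = suc zero} refl (step {v = zero} refl here)
    ; (suc (suc (suc zero))) → step {v = suc (suc zero)} refl (step {v = suc zero} refl (step {v = zero} refl here)) }) ,
  connected-from (complement P₄) zero (λ
    { zero                   → here
    ; (suc zero)             → step {v = suc (suc (suc zero))} refl (step {v = zero} refl here)
    ; (suc (suc zero))       → step {v = zero} refl here
    ; (suc (suc (suc zero))) → step {v = zero} refl here }) ,
  λ i j _ _ (p , q) _ → ⊥-elim (true≢false p (not-true (∧-elimʳ {not (i == j)} q)))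

-- The induction for minimum degree 2

Packing : ℕ → Set
Packing m = ∀ s (G : SimpleGraph (suc m)) → (∀ i → 2 ≤ deg G i) → 4 · m ≤ total G + 2 · ι s → Packs s (deg G)

restrict-≥2 : (G : SimpleGraph (suc n)) → (∀ i → 2 ≤ deg G (suc i)) → (∀ i → nbr G i ≡ true → 3 ≤ deg G (suc i)) → ∀ i → 2 ≤ deg (restrict G) i
restrict-≥2 G low high i with nbr G i in e | deg-suc G i
... | true  | eq = ≤-pred (≤-trans (high i e) (≤-reflexive eq))
... | false | eq = ≤-trans (low i) (≤-reflexive eq)

-- Deleting `zero` costs twice its degree in the degree sum; the last hypothesis makes the remainder
-- meet the bound for one vertex fewer.
remove-vertex : Packing m → ∀ s (G : SimpleGraph (suc (suc m))) → (∀ i → 2 ≤ deg G i) → (∀ i → nbr G i ≡ true → 3 ≤ deg G (suc i)) →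
  4 · m + (deg G zero + deg G zero) ≤ total G + 2 · ι s → Packs s (deg G)
remove-vertex {m} ih s G low high big = packs-vertex G (low zero) (ih s (restrict G) (restrict-≥2 G (low ∘ suc) high)
  (≤-from (4 · m) _ 0 (≤-trans big (≤-reflexive (cong (_+ 2 · ι s) (total-restrict G)))) (eq m (deg G zero + deg G zero) (total (restrict G)) (2 · ι s))))
  where
  eq : ∀ m d t s → 4 · m + (d + t + s) + 0 ≡ t + s + (4 · m + d)
  eq = solve-∀

-- The degree sum falls by 4 together with the bound, so no slack is consumed. All degrees stay at
-- least 2 because only `c` loses one.
pinch-vertex : Packing m → ∀ s (G : SimpleGraph (suc (suc m))) {a b c : Fin (suc m)} → Row₃ (nbr G) a b c → adj (restrict G) a b ≡ false →
  (∀ i → 3 ≤ deg G i) → 4 · suc m ≤ total G + 2 · ι s → Packs s (deg G)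
pinch-vertex {m} ih s G {a} {b} {c} row ab 3≤d big = packs-pinch (3≤d (suc a)) (ih s G′ low
  (≤-from (4 · m) _ 0 (≤-trans big (≤-reflexive (cong (_+ 2 · ι s) total-G′))) (eq m (total G′) (2 · ι s))))
  where
  open Pinch G row (λ p → proj₁ (proj₂ (row₃-head row)) (≡.sym p)) ab {s}
  low : ∀ i → 2 ≤ deg G′ i
  low i = ≤-from 2 (deg G′ i) 0 (≤-trans (≤-trans (3≤d (suc i)) (≤-reflexive (deg-G′ i))) (+-monoʳ-≤ (deg G′ i) (ι≤1 (c == i)))) (eq′ (deg G′ i))
    where
    eq′ : ∀ d → 2 + (d + 1) + 0 ≡ d + 3
    eq′ = solve-∀
  eq : ∀ m t s → 4 · m + (t + 4 + s) + 0 ≡ t + s + 4 · suc m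
  eq = solve-∀

module Cubic (ih : Packing m) (s : Bool) (G : SimpleGraph (suc (suc m))) (d≡3 : deg G zero ≡ 3) (3≤d : ∀ i → 3 ≤ deg G i)
  (big : 4 · suc m ≤ total G + 2 · ι s) where

  R : SimpleGraph (suc m)
  R = restrict G

  Broken : Fin (suc m) → Fin (suc m) → Set
  Broken p q = ∃[ R′ ] ((∀ i → deg R′ i ≡ deg R i) × adj R′ p q ≡ false)

  from-broken : ∀ {a b c} → Row₃ (nbr G) a b c → Broken a b → Packs s (deg G)
  from-broken row (R′ , same , ab) = packs-cong same⁺ (pinch-vertex ih s (extend R′ (nbr G)) row ab
    (λ i → ≤-trans (3≤d i) (≤-reflexive (≡.sym (same⁺ i)))) (≤-trans big (≤-reflexive (cong (_+ 2 · ι s) (sum-cong-≗ (≡.sym ∘ same⁺))))))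
    where
    same⁺ = deg-extend-same G R′ same

  broken-or-blocked : ∀ {p q} → nbr G p ≡ true → nbr G q ≡ true → Broken p q ⊎ (adj R p q ≡ true × Blocked R (nbr G) p q)
  broken-or-blocked {p} {q} rp rq = by-adj (adj R p q) refl
    where
    by-adj : ∀ u → adj R p q ≡ u → Broken p q ⊎ (adj R p q ≡ true × Blocked R (nbr G) p q)
    by-adj false pq = inj₁ (R , (λ _ → refl) , pq)
    by-adj true  pq = Data.Sum.map₂ (pq ,_) (break-or-blocked R (nbr G) rp rq pq)

  -- A pair of neighbours of `zero` is non-adjacent, or can be made so by a switch inside `R`, or is
  -- adjacent and blocked. Either of the first two permits pinching; three blocked pairs permit
  -- discharging.
  pinch-or-bound : Packs s (deg G) ⊎ suc m · 5 ≤ total R + 9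
  pinch-or-bound = from-row (enum₃ (nbr G) (trans (≡.sym (deg-zero G)) d≡3))
    where
    outer : ∀ w → nbr G w ≡ false → 3 ≤ deg R w
    outer w e = ≤-trans (3≤d (suc w)) (≤-reflexive (trans (deg-suc G w) (cong (λ u → ι u + deg R w) e)))
    from-row : ∃[ a ] ∃[ b ] ∃[ c ] (∀ j → ι (nbr G j) ≡ δ a j + (δ b j + δ c j)) → Packs s (deg G) ⊎ suc m · 5 ≤ total R + 9
    from-row (a , b , c , split) = by-pairs (broken-or-blocked a∈ b∈) (broken-or-blocked b∈ c∈) (broken-or-blocked c∈ a∈)
      where
      row : Row₃ (nbr G) a b c
      row = row₃ split
      a∈ = proj₁ (row₃-head row)
      b∈ = proj₁ (row₃-head (row₃-rotate row))
      c∈ = proj₁ (row₃-head (row₃-rotate (row₃-rotate row)))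
      Pair : Fin (suc m) → Fin (suc m) → Set
      Pair p q = Broken p q ⊎ (adj R p q ≡ true × Blocked R (nbr G) p q)
      by-pairs : Pair a b → Pair b c → Pair c a → Packs s (deg G) ⊎ suc m · 5 ≤ total R + 9
      by-pairs (inj₁ p) _ _ = inj₁ (from-broken row p)
      by-pairs (inj₂ _) (inj₁ p) _ = inj₁ (from-broken (row₃-rotate row) p)
      by-pairs (inj₂ _) (inj₂ _) (inj₁ p) = inj₁ (from-broken (row₃-rotate (row₃-rotate row)) p)
      by-pairs (inj₂ (ab , bl-ab)) (inj₂ (bc , bl-bc)) (inj₂ (ca , bl-ca)) =
        inj₂ (Discharging.total-bound R (nbr G) row ab bc ca outer bl-ab bl-bc bl-ca)

-- The degree sum is even, so it cannot miss the bound by exactly one.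
even-gap : (G : SimpleGraph n) → ∀ k b → ¬ (k + k + 2 ≤ total G + 2 · b) → total G + 2 · b ≤ k + k
even-gap G k b small with total-even G
... | e , eq rewrite eq = ≤-trans (≤-reflexive (double e b)) (+-mono-≤ half half)
  where
  double : ∀ e b → e + e + 2 · b ≡ (e + b) + (e + b)
  double = solve-∀
  double′ : ∀ k → k + k + 2 ≡ suc k + suc k
  double′ = solve-∀
  half : e + b ≤ k
  half = ≤-pred (≰⇒> λ p → small (≤-trans (≤-reflexive (double′ k)) (≤-trans (+-mono-≤ p p) (≤-reflexive (≡.sym (double e b))))))

-- Here `total (restrict G)` is `total G` minus 6, so the bounds give `5 · suc m ≤ 4 · suc m + 3`,
-- that is, `m ≤ 2`.
bounded-blocked : (G : SimpleGraph (suc (suc m))) → deg G zero ≡ 3 → ∀ b → 3 ≤ m →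
  total G + b ≤ 4 · suc m → ¬ (suc m · 5 ≤ total (restrict G) + 9)
bounded-blocked {m} G d≡3 b 3≤m small bound =
  absurd-from b (+-mono-≤ 3≤m (+-mono-≤ bound (≤-trans (≤-reflexive (cong (_+ b) (≡.sym expand))) small))) (eq m (total (restrict G)) b)
  where
  expand : total G ≡ 6 + total (restrict G)
  expand = trans (total-restrict G) (cong (λ d → d + d + total (restrict G)) d≡3)
  eq : ∀ m t b → suc (m + (t + 9 + 4 · suc m) + b) ≡ 3 + (suc m · 5 + (6 + t + b))
  eq = solve-∀

packs-cubic : Packing m → 2 ≤ m → ∀ s (G : SimpleGraph (suc (suc m))) → deg G zero ≡ 3 → (∀ i → 3 ≤ deg G i) →
  4 · suc m ≤ total G + 2 · ι s → total G + 2 · ι s ≤ 4 · suc m → Packs s (deg G)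
packs-cubic {m} ih 2≤m s G d≡3 3≤d big small with m≤n⇒m<n∨m≡n 2≤m
-- For `m = 2` there are four vertices of degree at least 3.
... | inj₂ refl = packs-K₄ G 3≤d
... | inj₁ 3≤m  = Data.Sum.[ id , (λ bound → contradiction bound (bounded-blocked G d≡3 (2 · ι s) 3≤m small)) ] (Cubic.pinch-or-bound ih s G d≡3 3≤d big)

module Front (ih : Packing m) (2≤m : 2 ≤ m) (s : Bool) (G : SimpleGraph (suc (suc m))) (low : ∀ i → 2 ≤ deg G i)
  (least : ∀ i → deg G zero ≤ deg G i) (big : 4 · suc m ≤ total G + 2 · ι s) where

  degree-2 : deg G zero ≡ 2 → Packs s (deg G)
  degree-2 d≡ = from-improved (Improve.improve G zero (≤-reflexive d≡) (two-strong G (s≤s 2≤m) (≤-trans big (+-monoʳ-≤ (total G) (*-monoʳ-≤ 2 (ι≤1 s))))))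
    where
    eq : ∀ m → 4 · m + 4 ≡ 4 · suc m
    eq = solve-∀
    from-improved : Improved G zero → Packs s (deg G)
    from-improved (G′ , same , high) = packs-cong same (remove-vertex ih s G′
      (λ i → ≤-trans (low i) (≤-reflexive (≡.sym (same i))))
      (λ i e → ≤-trans (high (suc i) e) (≤-reflexive (≡.sym (same (suc i)))))
      (≤-trans (≤-reflexive (trans (cong (λ d → 4 · m + (d + d)) (trans (same zero) d≡)) (eq m)))
        (≤-trans big (≤-reflexive (cong (_+ 2 · ι s) (sum-cong-≗ (≡.sym ∘ same)))))))

  degree-3 : deg G zero ≡ 3 → Packs s (deg G)
  -- Deletion costs 6, two more than the drop of the bound. Where these two units are missing,
  -- parity leaves equality. The bound is written as a double to suit `even-gap`.
  degree-3 d≡ = by-total (2 · suc m + 2 · suc m + 2 ≤? total G + 2 · ι s)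
    where
    eq : ∀ m → 4 · m + (3 + 3) ≡ 2 · suc m + 2 · suc m + 2
    eq = solve-∀
    eq′ : ∀ m → 2 · suc m + 2 · suc m ≡ 4 · suc m
    eq′ = solve-∀
    3≤d : ∀ i → 3 ≤ deg G i
    3≤d i = ≤-trans (≤-reflexive (≡.sym d≡)) (least i)
    by-total : Dec (2 · suc m + 2 · suc m + 2 ≤ total G + 2 · ι s) → Packs s (deg G)
    by-total (yes large) = remove-vertex ih s G low (λ i _ → 3≤d (suc i))
      (≤-trans (≤-reflexive (trans (cong (λ d → 4 · m + (d + d)) d≡) (eq m))) large)
    by-total (no small) = packs-cubic ih 2≤m s G d≡ 3≤d big
      (≤-trans (even-gap G (2 · suc m) (ι s) small) (≤-reflexive (eq′ m)))

  -- By minimality the degree sum is at least `(2 + m) · (4 + k)`, which exceeds the bound for `m`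
  -- plus the cost of deletion by `m · k`.
  degree-≥4 : ∀ k → deg G zero ≡ 4 + k → Packs s (deg G)
  degree-≥4 k d≡ = remove-vertex ih s G low (λ i _ → ≤-trans (s≤s (s≤s (s≤s z≤n))) (4+k≤d (suc i)))
    (≤-trans (≤-reflexive (cong (λ d → 4 · m + (d + d)) d≡)) (≤-trans (≤-trans (m≤m+n _ (m · k)) (≤-reflexive (eq m k))) (≤-trans all-large (m≤m+n _ _))))
    where
    4+k≤d : ∀ i → 4 + k ≤ deg G i
    4+k≤d i = ≤-trans (≤-reflexive (≡.sym d≡)) (least i)
    all-large : (2 + m) · (4 + k) ≤ total G
    all-large = ≤-trans (≤-reflexive (≡.sym (sum-const (2 + m) (4 + k)))) (sum-mono 4+k≤d)
    eq : ∀ m k → 4 · m + (4 + k + (4 + k)) + m · k ≡ (2 + m) · (4 + k)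
    eq = solve-∀

  packs-front : Packs s (deg G)
  packs-front = by-degree (deg G zero) refl
    where
    by-degree : ∀ d → deg G zero ≡ d → Packs s (deg G)
    by-degree 0 d≡ = contradiction (≤-trans (low zero) (≤-reflexive d≡)) λ ()
    by-degree 1 d≡ = contradiction (≤-trans (low zero) (≤-reflexive d≡)) λ { (s≤s ()) }
    by-degree 2 d≡ = degree-2 d≡
    by-degree 3 d≡ = degree-3 d≡
    by-degree (suc (suc (suc (suc k)))) d≡ = degree-≥4 k d≡

packing-step : Packing m → 2 ≤ m → Packing (suc m)
packing-step ih 2≤m s G low big with argmin (deg G)
... | v , least = packs-at v G (Front.packs-front ih 2≤m s G⁰
    (λ i → ≤-trans (low _) (≤-reflexive (≡.sym (deg-relabel π G i))))
    (λ i → ≤-trans (≤-reflexive (deg-relabel π G zero)) (≤-trans (least _) (≤-reflexive (≡.sym (deg-relabel π G i)))))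
    (≤-trans big (≤-reflexive (cong (_+ 2 · ι s) (≡.sym (total-relabel π G))))))
  where
  π = bring-to-front v
  G⁰ = relabel π G

packing : ∀ m → Packing m
packing 0 s G low big = contradiction (≤-trans (low zero) (deg≤ G zero)) λ ()
packing 1 s G low big = contradiction (≤-trans (low zero) (deg≤ G zero)) λ { (s≤s ()) }
-- A triangle: deleting a vertex leaves a single edge, which both subgraphs use.
packing 2 true  G low big = packs-vertex G (low zero) (packs-K₂ (restrict G) (complete G (low (suc zero)) λ ()))
-- Three vertices have degree sum at most 6, below the required 8.
packing 2 false G low big = contradiction (≤-trans big (≤-trans (≤-reflexive (+-identityʳ (total G))) (sum-mono (deg≤ G)))) (<⇒≱ (s≤s (s≤s (s≤s (s≤s (s≤s (s≤s (s≤s z≤n))))))))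
packing (suc (suc (suc m))) = packing-step (packing (suc (suc m))) (s≤s (s≤s z≤n))

-- A vertex of degree 1

no-leaf-on-three : (G : SimpleGraph 3) → deg G zero ≡ 1 → ¬ (8 ≤ total G + 2)
-- The degree sum is at most 1 + 2 + 2.
no-leaf-on-three G d≡1 big = contradiction (≤-trans big (+-monoˡ-≤ 2 (+-mono-≤ (≤-reflexive d≡1) (sum-mono (deg≤ G ∘ suc))))) (<⇒≱ ≤-refl)

-- The neighbour of the leaf must retain degree 2 after deletion, so it is first exchanged for a
-- vertex of degree at least 3. Deletion lowers the degree sum by 2, leaving `4 · m`, the bound for
-- disjoint subgraphs.
packing-leaf-front : 2 ≤ m → (G : SimpleGraph (suc (suc m))) → deg G zero ≡ 1 → (∀ i → 2 ≤ deg G (suc i)) → 4 · suc m ≤ total G + 2 → Packs true (deg G)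
packing-leaf-front {m} 2≤m G d≡1 low big = from-improved (Improve.improve G zero (≤-trans (≤-reflexive d≡1) (s≤s z≤n)) (two-strong G (s≤s 2≤m) big))
  where
  eq : ∀ m t → 4 · m + (2 + t + 2) + 0 ≡ t + 2 · 0 + 4 · suc m
  eq = solve-∀
  from-improved : Improved G zero → Packs true (deg G)
  from-improved (G′ , same , high) = packs-cong same (packs-leaf G′ (trans (same zero) d≡1) (packing m false (restrict G′)
    (restrict-≥2 G′ (λ i → ≤-trans (low i) (≤-reflexive (≡.sym (same (suc i))))) (λ i e → ≤-trans (high (suc i) e) (≤-reflexive (≡.sym (same (suc i))))))
    (≤-from (4 · m) _ 0 (≤-trans big (≤-reflexive (cong (_+ 2) totals))) (eq m (total (restrict G′))))))
    where
    totals : total G ≡ 2 + total (restrict G′)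
    totals = trans (sum-cong-≗ (≡.sym ∘ same)) (trans (total-restrict G′) (cong (λ d → d + d + total (restrict G′)) (trans (same zero) d≡1)))

packing-leaf : 1 ≤ m → (G : SimpleGraph (suc (suc m))) (v : Fin (suc (suc m))) → deg G v ≡ 1 → (∀ i → v ≢ i → 2 ≤ deg G i) → 4 · suc m ≤ total G + 2 → Packs true (deg G)
packing-leaf {m} 1≤m G v d≡1 low big = packs-at v G (by-size (m≤n⇒m<n∨m≡n 1≤m))
  where
  π  = bring-to-front v
  G⁰ = relabel π G
  zero≢suc : ∀ {i : Fin (suc m)} → zero ≢ suc i
  zero≢suc ()
  d⁰ : deg G⁰ zero ≡ 1
  d⁰ = trans (deg-relabel π G zero) d≡1
  low⁰ : ∀ i → 2 ≤ deg G⁰ (suc i)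
  low⁰ i = ≤-trans (low _ (λ e → zero≢suc (perm-injective π {zero} {suc i} e))) (≤-reflexive (≡.sym (deg-relabel π G (suc i))))
  big⁰ : 4 · suc m ≤ total G⁰ + 2
  big⁰ = ≤-trans big (≤-reflexive (cong (_+ 2) (≡.sym (total-relabel π G))))
  by-size : 1 < m ⊎ 1 ≡ m → Packs true (deg G⁰)
  by-size (inj₁ 2≤m)  = packing-leaf-front 2≤m G⁰ d⁰ low⁰ big⁰
  by-size (inj₂ refl) = contradiction big⁰ (no-leaf-on-three G⁰ d⁰)

-- Spanning trees from distances

least : {P : ℕ → Set} → (∀ k → Dec (P k)) → ∀ k → P k → ∃[ l ] (P l × (∀ j → P j → l ≤ j))
least P? zero    p = zero , p , λ _ _ → z≤n
least P? (suc k) p with P? zero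
... | yes q = zero , q , λ _ _ → z≤n
... | no ¬q with least (P? ∘ suc) k p
...   | l , q , small = suc l , q , λ { zero r → contradiction r ¬q ; (suc j) r → s≤s (small j r) }

record Rooting (G : SimpleGraph n) (r : Fin n) : Set where
  field
    parent : Fin n → Fin n
    level  : Fin n → ℕ
    edge   : ∀ i → i ≢ r → adj G i (parent i) ≡ true
    lower  : ∀ i → i ≢ r → level (parent i) < level i

module Distance (G : SimpleGraph n) (r : Fin n) where

  Reach : ℕ → Fin n → Set
  Reach zero    i = i ≡ r
  Reach (suc k) i = ∃[ j ] (adj G i j ≡ true × Reach k j)

  reach? : ∀ k i → Dec (Reach k i)
  reach? zero    i = i ≟ r
  reach? (suc k) i = any? (λ j → (adj G i j ≟ᵇ true) ×-dec reach? k j)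

  reach : ∀ {i} → Walk G i r → ∃[ k ] Reach k i
  reach here       = zero , refl
  reach (step e p) = suc (proj₁ (reach p)) , _ , e , proj₂ (reach p)

  module _ (conn : Connected G) where

    dist : ∀ i → ∃[ l ] (Reach l i × (∀ j → Reach j i → l ≤ j))
    dist i = least (λ k → reach? k i) _ (proj₂ (reach (conn i r)))

    -- The first step of a shortest walk to `r`: the rest of that walk bounds the distance from its
    -- end.
    next : ∀ i → i ≢ r → ∃[ j ] (adj G i j ≡ true × proj₁ (dist j) < proj₁ (dist i))
    next i i≢r with dist i
    ... | zero  , i≡r , _ = contradiction i≡r i≢r
    ... | suc l , (j , e , p) , _ = j , e , s≤s (proj₂ (proj₂ (dist j)) l p)

    par : ∀ i → Dec (i ≡ r) → Fin n
    -- A default at the root, where `Rooting` imposes no condition.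
    par i (yes _)  = r
    par i (no i≢r) = proj₁ (next i i≢r)

    par-spec : ∀ i (d : Dec (i ≡ r)) → i ≢ r → adj G i (par i d) ≡ true × proj₁ (dist (par i d)) < proj₁ (dist i)
    par-spec i (yes i≡r) i≢r = contradiction i≡r i≢r
    par-spec i (no i≢r)  _   = proj₂ (next i i≢r)

    rooting : Rooting G r
    rooting = record
      { parent = λ i → par i (i ≟ r)
      ; level  = λ i → proj₁ (dist i)
      ; edge   = λ i i≢r → proj₁ (par-spec i (i ≟ r) i≢r)
      ; lower  = λ i i≢r → proj₂ (par-spec i (i ≟ r) i≢r)
      }

last : Fin n → List (Fin n) → Fin n
last x []       = x
last x (y ∷ ys) = last y ys

head : List (Fin n) → Fin n → Fin n
head []      e = e
head (y ∷ _) e = y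

All-last : {P : Fin n → Set} → ∀ {x xs} → All P (x ∷ xs) → P (last x xs)
All-last (p ∷ [])     = p
All-last (_ ∷ q ∷ ps) = All-last (q ∷ ps)

module ParentTree {G : SimpleGraph n} {r : Fin n} (ρ : Rooting G r) where
  open Rooting ρ

  toParent : Fin n → Fin n → Bool
  toParent i j = not (r == i) ∧ (parent i == j)

  toParent-sound : ∀ i j → toParent i j ≡ true → i ≢ r × parent i ≡ j
  toParent-sound i j e = (λ { refl → true≢false (∧-elimˡ e) (cong not (==-refl i)) }) , ==-sound (∧-elimʳ {not (r == i)} e)

  toParent-adj : ∀ i j → toParent i j ≡ true → adj G i j ≡ true
  toParent-adj i j e with toParent-sound i j e
  ... | i≢r , refl = edge i i≢r

  toParent-lower : ∀ i j → toParent i j ≡ true → level j < level i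
  toParent-lower i j e with toParent-sound i j e
  ... | i≢r , refl = lower i i≢r

  toParent-parent : ∀ {i} → i ≢ r → toParent i (parent i) ≡ true
  toParent-parent {i} i≢r rewrite ==-≢ (i≢r ∘ ≡.sym) = ==-refl (parent i)

  sum-toParent : sum (λ i → sum (λ j → ι (toParent i j))) + 1 ≡ n
  sum-toParent = begin
    sum (λ i → sum (λ j → ι (toParent i j))) + 1          ≡⟨ cong₂ _+_ (sum-cong-≗ inner) (≡.sym (sum-δ r)) ⟩
    sum (λ i → ι (not (r == i))) + sum (δ r)              ≡⟨ ∑-distrib-+ (λ i → ι (not (r == i))) (δ r) ⟨
    sum (λ i → ι (not (r == i)) + δ r i)                  ≡⟨ sum-cong-≗ (λ i → one (r == i)) ⟩
    sum {n} (λ _ → 1)                                     ≡⟨ sum-const n 1 ⟩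
    n · 1                                                 ≡⟨ *-identityʳ n ⟩
    n                                                     ∎
    where
    open ≡.≡-Reasoning
    one : ∀ b → ι (not b) + ι b ≡ 1
    one true  = refl
    one false = refl
    inner : ∀ i → sum (λ j → ι (toParent i j)) ≡ ι (not (r == i))
    inner i with r == i
    ... | true  = sum-zero {f = λ j → ι (false ∧ (parent i == j))} (λ _ → refl)
    ... | false = sum-δ (parent i)

  -- There are `n - 1` arcs to parents. As they lower the level, no edge carries two of them, so
  -- each accounts for two units of the degree sum.
  total-≥ : n + n ≤ total G + 2
  total-≥ = begin
    n + n                        ≡⟨ cong₂ _+_ sum-toParent sum-toParent ⟨
    (s + 1) + (s + 1)            ≡⟨ shuffle s ⟩
    (s + s) + 2                  ≤⟨ +-monoˡ-≤ 2 twice ⟩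
    total G + 2                  ∎
    where
    open ≤-Reasoning
    s = sum (λ i → sum (λ j → ι (toParent i j)))
    shuffle : ∀ s → (s + 1) + (s + 1) ≡ (s + s) + 2
    shuffle = solve-∀
    pointwise : ∀ i j → ι (toParent i j) + ι (toParent j i) ≤ ι (adj G i j)
    pointwise i j with toParent i j in p | toParent j i in q
    ... | false | false = z≤n
    ... | true  | false = ≤-reflexive (cong ι (≡.sym (toParent-adj i j p)))
    ... | false | true  = ≤-reflexive (cong ι (≡.sym (adj-sym G (toParent-adj j i q))))
    ... | true  | true  = contradiction (<-trans (toParent-lower i j p) (toParent-lower j i q)) (<-irrefl refl)
    twice : s + s ≤ total G
    twice = begin
      s + s                                                                        ≡⟨ cong (s +_) (∑-comm (λ i j → ι (toParent i j))) ⟩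
      s + sum (λ i → sum (λ j → ι (toParent j i)))                                 ≡⟨ ∑-distrib-+ (λ i → sum (λ j → ι (toParent i j))) _ ⟨
      sum (λ i → sum (λ j → ι (toParent i j)) + sum (λ j → ι (toParent j i)))      ≡⟨ sum-cong-≗ (λ i → ∑-distrib-+ (λ j → ι (toParent i j)) _) ⟨
      sum (λ i → sum (λ j → ι (toParent i j) + ι (toParent j i)))                  ≤⟨ sum-mono (λ i → sum-mono (pointwise i)) ⟩
      total G                                                                      ∎

  irrefl-toParent : ∀ i → toParent i i ≡ false
  irrefl-toParent i with toParent i i in e
  ... | false = refl
  ... | true  = contradiction refl (adj-≢ G (toParent-adj i i e))

  tree : SimpleGraph n
  tree .adj i j = toParent i j ∨ toParent j i
  tree .sym i j = ∨-comm (toParent i j) (toParent j i)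
  tree .irrfl i rewrite irrefl-toParent i = refl

  tree-sub : Subgraph tree G
  tree-sub i j e with ∨-elim {toParent i j} e
  ... | inj₁ p = toParent-adj i j p
  ... | inj₂ p = adj-sym G (toParent-adj j i p)

  to-root : ∀ k i → level i ≤ k → Walk tree i r
  to-root k i l with i ≟ r
  ... | yes refl = here
  to-root zero    i l | no i≢r = contradiction (≤-trans (lower i i≢r) l) λ ()
  to-root (suc k) i l | no i≢r = step {v = parent i} (∨-introˡ (toParent-parent i≢r)) (to-root k (parent i) (≤-pred (≤-trans (lower i i≢r) l)))

  tree-connected : Connected tree
  tree-connected = connected-from tree r (λ i → to-root (level i) i ≤-refl)

  -- A non-backtracking path in the tree that goes down once keeps going
  -- down.  So a path from x to e either goes up all the way, or arrives at e
  -- from the parent of e; in the latter case it starts by going up or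
  -- goes down all the way.
  data Shape (x : Fin n) (ys : List (Fin n)) (e : Fin n) : Set where
    ascends  : parent x ≡ head ys e → level e < level x → Shape x ys e
    descends : parent e ≡ last x ys → parent x ≡ head ys e ⊎ level x < level e → Shape x ys e

  -- After a step down from `x` to `y`, an upward continuation would return to `x`, which
  -- `x ≢ head zs e` excludes.
  shape-cons : ∀ {x y zs e} → adj tree x y ≡ true → x ≢ head zs e → Shape y zs e → Shape x (y ∷ zs) e
  shape-cons {x} {y} xy x≢z sh with ∨-elim {toParent x y} xy
  shape-cons {x} {y} xy x≢z (ascends _ l)  | inj₁ p = ascends (proj₂ (toParent-sound x y p)) (<-trans l (toParent-lower x y p))
  shape-cons {x} {y} xy x≢z (descends q _) | inj₁ p = descends q (inj₁ (proj₂ (toParent-sound x y p)))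
  shape-cons {x} {y} xy x≢z (ascends q _)  | inj₂ p = contradiction (trans (≡.sym (proj₂ (toParent-sound y x p))) q) x≢z
  shape-cons {x} {y} xy x≢z (descends _ (inj₁ q)) | inj₂ p = contradiction (trans (≡.sym (proj₂ (toParent-sound y x p))) q) x≢z
  shape-cons {x} {y} xy x≢z (descends q (inj₂ l)) | inj₂ p = descends q (inj₂ (<-trans (toParent-lower y x p) l))

  shape : ∀ x ys e → Unique (x ∷ ys) → All (e ≢_) (x ∷ ys) → Chain tree (x ∷ ys ++ [ e ]) → Shape x ys e
  shape x [] e _ _ (xe , _) with ∨-elim {toParent x e} xe
  ... | inj₁ p = ascends (proj₂ (toParent-sound x e p)) (toParent-lower x e p)
  ... | inj₂ p = descends (proj₂ (toParent-sound e x p)) (inj₂ (toParent-lower e x p))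
  shape x (y ∷ []) e (_ ∷ u) (e≢x ∷ es) (xy , ch) = shape-cons xy (e≢x ∘ ≡.sym) (shape y [] e u es ch)
  shape x (y ∷ z ∷ zs) e ((_ ∷ x≢z ∷ _) ∷ u) (_ ∷ es) (xy , ch) = shape-cons xy x≢z (shape y (z ∷ zs) e u es ch)

  -- A cycle is a path from `v` back to `v`. Its shape puts `v` strictly below its own level, or
  -- makes both cycle neighbours of `v` its parent, although they are distinct.
  tree-acyclic : Acyclic tree
  tree-acyclic v (_ ∷ []) (s≤s () , _)
  tree-acyclic v (x ∷ y ∷ zs) (_ , ((v≢x ∷ v≢y ∷ v≢zs) ∷ (x≢ ∷ u)) , (vx , ch))
    with shape-cons {v} {x} {y ∷ zs} {v} vx v≢y (shape x (y ∷ zs) v (x≢ ∷ u) (v≢x ∷ v≢y ∷ v≢zs) ch)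
  ... | ascends _ l = <-irrefl refl l
  ... | descends _ (inj₂ l) = <-irrefl refl l
  ... | descends p (inj₁ q) = All-last x≢ (trans (≡.sym q) p)

  spanning-tree : IsTree tree
  spanning-tree = tree-connected , tree-acyclic

connected-total : (G : SimpleGraph n) → Connected G → n + n ≤ total G + 2
connected-total {zero}  G conn = z≤n
connected-total {suc n} G conn = ParentTree.total-≥ (Distance.rooting G zero conn)

has-spanning-tree : (G : SimpleGraph n) → Connected G → ∃[ T ] (Subgraph T G × IsTree T)
has-spanning-tree {zero}  G conn = G , (λ _ _ p → p) , conn , λ ()
has-spanning-tree {suc n} G conn = tree , tree-sub , spanning-tree
  where open ParentTree (Distance.rooting G zero conn)

-- Sharing for ordered and unordered pairs; from packings to trees

symmetric-share : {T₁ T₂ : SimpleGraph n} → ShareAtMostOneEdge T₁ T₂ → Share true T₁ T₂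
symmetric-share {n} {T₁} {T₂} sh i j k l (p , q) (p′ , q′) = refl , compare (<-cmp (toℕ i) (toℕ j)) (<-cmp (toℕ k) (toℕ l))
  where
  compare : Tri (toℕ i < toℕ j) (toℕ i ≡ toℕ j) (toℕ j < toℕ i) → Tri (toℕ k < toℕ l) (toℕ k ≡ toℕ l) (toℕ l < toℕ k) → SameEdge i j k l
  compare (tri≈ _ e _) _ = contradiction (toℕ-injective e) (adj-≢ T₁ p)
  compare _ (tri≈ _ e _) = contradiction (toℕ-injective e) (adj-≢ T₁ p′)
  compare (tri< a _ _) (tri< b _ _) = inj₁ (sh i j k l a b p q p′ q′)
  compare (tri< a _ _) (tri> _ _ b) = inj₂ (sh i j l k a b p q (adj-sym T₁ p′) (adj-sym T₂ q′))
  compare (tri> _ _ a) (tri< b _ _) = let e , f = sh j i k l a b (adj-sym T₁ p) (adj-sym T₂ q) p′ q′ in inj₂ (f , e)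
  compare (tri> _ _ a) (tri> _ _ b) = let e , f = sh j i l k a b (adj-sym T₁ p) (adj-sym T₂ q) (adj-sym T₁ p′) (adj-sym T₂ q′) in inj₁ (f , e)

ordered-share : {T₁ T₂ : SimpleGraph n} → Share true T₁ T₂ → ShareAtMostOneEdge T₁ T₂
ordered-share sh i j k l i<j k<l p q p′ q′ with sh i j k l (p , q) (p′ , q′)
... | _ , inj₁ same = same
... | _ , inj₂ (refl , refl) = contradiction (<-trans i<j k<l) (<-irrefl refl)

SpanningPair : SimpleGraph n → Set
SpanningPair G = ∃[ T₁ ] ∃[ T₂ ] (IsSpanningTree T₁ G × IsSpanningTree T₂ G × ShareAtMostOneEdge T₁ T₂)

packs⇒pair : {d : Fin n → ℕ} → Packs true d → ∃[ G ] (Realizes G d × SpanningPair G)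
packs⇒pair (G , r , C₁ , C₂ , s₁ , s₂ , c₁ , c₂ , sh) with has-spanning-tree C₁ c₁ | has-spanning-tree C₂ c₂
... | T₁ , t₁ , tree₁ | T₂ , t₂ , tree₂ =
  G , (λ i → trans (degree≡deg G i) (r i)) , T₁ , T₂ ,
  ((λ i j p → s₁ i j (t₁ i j p)) , tree₁) , ((λ i j p → s₂ i j (t₂ i j p)) , tree₂) ,
  ordered-share {T₁ = T₁} {T₂} (share-sub {C₁ = C₁} {C₂} {T₁} {T₂} t₁ t₂ sh)

-- Necessity: counting edges and leaves

intersection : SimpleGraph n → SimpleGraph n → SimpleGraph n
intersection G H .adj i j = adj G i j ∧ adj H i j
intersection G H .sym i j = cong₂ _∧_ (sym G i j) (sym H i j)
intersection G H .irrfl i rewrite irrfl G i = refl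

total-intersection : {C₁ C₂ : SimpleGraph n} → Share true C₁ C₂ → total (intersection C₁ C₂) ≤ 2
total-intersection {n} {C₁} {C₂} sh with any? (λ i → any? (λ j → adj (intersection C₁ C₂) i j ≟ᵇ true))
... | no none = ≤-trans (≤-reflexive (sum-zero (λ i → sum-zero (λ j → cong ι (absent i j))))) z≤n
  where
  absent : ∀ i j → adj (intersection C₁ C₂) i j ≡ false
  absent i j with adj (intersection C₁ C₂) i j in e
  ... | false = refl
  ... | true  = contradiction (i , j , e) none
... | yes (u , v , e) = begin
  total (intersection C₁ C₂)                    ≤⟨ sum-mono (λ i → sum-mono (only i)) ⟩
  sum (λ i → sum (λ j → ι (isEdge u v i j)))    ≡⟨ sum-cong-≗ (sum-isEdge (adj-≢ (intersection C₁ C₂) e)) ⟩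
  sum (λ i → δ u i + δ v i)                     ≡⟨ ∑-distrib-+ (δ u) (δ v) ⟩
  sum (δ u) + sum (δ v)                         ≡⟨ cong₂ _+_ (sum-δ u) (sum-δ v) ⟩
  2                                             ∎
  where
  open ≤-Reasoning
  both : ∀ {i j} → adj (intersection C₁ C₂) i j ≡ true → Shared C₁ C₂ i j
  both {i} {j} p = ∧-elimˡ p , ∧-elimʳ {adj C₁ i j} p
  only : ∀ i j → ι (adj (intersection C₁ C₂) i j) ≤ ι (isEdge u v i j)
  only i j with adj (intersection C₁ C₂) i j in p
  ... | false = z≤n
  ... | true with sh u v i j (both e) (both p)
  ...   | _ , inj₁ (refl , refl) = ≤-reflexive (cong ι (≡.sym (isEdge-self u v)))
  ...   | _ , inj₂ (refl , refl) = ≤-reflexive (cong ι (≡.sym (trans (isEdge-sym u v v u) (isEdge-self u v))))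

-- Inclusion and exclusion, entry by entry in the adjacency matrices.
total-union : {C₁ C₂ G : SimpleGraph n} → Subgraph C₁ G → Subgraph C₂ G → total C₁ + total C₂ ≤ total G + total (intersection C₁ C₂)
total-union {C₁ = C₁} {C₂} {G} s₁ s₂ = begin
  total C₁ + total C₂                                                 ≡⟨ ∑-distrib-+ (deg C₁) (deg C₂) ⟨
  sum (λ i → deg C₁ i + deg C₂ i)                                     ≡⟨ sum-cong-≗ (λ i → ∑-distrib-+ (ι ∘ adj C₁ i) (ι ∘ adj C₂ i)) ⟨
  sum (λ i → sum (λ j → ι (adj C₁ i j) + ι (adj C₂ i j)))             ≤⟨ sum-mono (λ i → sum-mono (pointwise i)) ⟩
  sum (λ i → sum (λ j → ι (adj G i j) + ι (adj C₁ i j ∧ adj C₂ i j))) ≡⟨ sum-cong-≗ (λ i → ∑-distrib-+ (ι ∘ adj G i) (λ j → ι (adj C₁ i j ∧ adj C₂ i j))) ⟩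
  sum (λ i → deg G i + deg (intersection C₁ C₂) i)                    ≡⟨ ∑-distrib-+ (deg G) (deg (intersection C₁ C₂)) ⟩
  total G + total (intersection C₁ C₂)                                ∎
  where
  open ≤-Reasoning
  pointwise : ∀ i j → ι (adj C₁ i j) + ι (adj C₂ i j) ≤ ι (adj G i j) + ι (adj C₁ i j ∧ adj C₂ i j)
  pointwise i j with adj C₁ i j in p | adj C₂ i j in q
  ... | false | false = z≤n
  ... | true  | false rewrite s₁ i j p = ≤-refl
  ... | false | true  rewrite s₂ i j q = ≤-refl
  ... | true  | true  rewrite s₁ i j p = ≤-refl

-- `4 · suc m ≤ total C₁ + total C₂ + 4 ≤ total G + 6`, where the shared edge contributes 2 to the
-- last step.
pair-total : {C₁ C₂ G : SimpleGraph (suc m)} → Subgraph C₁ G → Subgraph C₂ G → Connected C₁ → Connected C₂ → Share true C₁ C₂ → 4 · m ≤ total G + 2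
pair-total {m} {C₁} {C₂} {G} s₁ s₂ c₁ c₂ sh =
  ≤-from (4 · m) _ 0 (+-mono-≤ (+-mono-≤ (connected-total C₁ c₁) (connected-total C₂ c₂)) (+-mono-≤ (total-union {C₁ = C₁} {C₂} {G} s₁ s₂) (total-intersection {C₁ = C₁} {C₂} sh)))
    (eq m (total C₁) (total C₂) (total G) (total (intersection C₁ C₂)))
  where
  eq : ∀ m a b g s → 4 · m + (a + 2 + (b + 2) + (g + s + 2)) + 0 ≡ g + 2 + (suc m + suc m + (suc m + suc m) + (a + b + s))
  eq = solve-∀

two-true : (f : Fin n → Bool) {x y : Fin n} → f x ≡ true → f y ≡ true → x ≢ y → 2 ≤ sum (ι ∘ f)
two-true f {x} {y} fx fy x≢y rewrite sum-without f x fx =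
  s≤s (≤-trans (≤-reflexive (cong ι (≡.sym (without-keep f fy x≢y)))) (sum-≥ (ι ∘ without f x) y))

first-step : (C : SimpleGraph n) → Connected C → ∀ {u w} → u ≢ w → ∃[ x ] adj C u x ≡ true
first-step C conn {u} {w} u≢w with conn u w
... | here = contradiction refl u≢w
... | step {v = x} e _ = x , e

walk-within : {C : SimpleGraph n} (P : Fin n → Set) → (∀ i j → adj C i j ≡ true → P i → P j) → ∀ {u w} → Walk C u w → P u → P w
walk-within P closed here       p = p
walk-within P closed (step e q) p = walk-within P closed q (closed _ _ e p)

-- A vertex of degree 1 has its only edge in both subgraphs; if there were
-- two such vertices, that edge would join them and cut them off from the rest.
one-leaf : {C₁ C₂ G : SimpleGraph n} → Subgraph C₁ G → Subgraph C₂ G → Connected C₁ → Connected C₂ → Share true C₁ C₂ →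
  ∀ {u v w} → u ≢ v → u ≢ w → v ≢ w → deg G u ≤ 1 → deg G v ≤ 1 → ⊥
one-leaf {n} {C₁} {C₂} {G} s₁ s₂ c₁ c₂ sh {u} {v} {w} u≢v u≢w v≢w du dv = conclude (shared-edge u≢v du) (shared-edge (u≢v ∘ ≡.sym) dv)
  where
  unique : ∀ {u x y} → deg G u ≤ 1 → adj G u x ≡ true → adj G u y ≡ true → x ≡ y
  unique {u} {x} {y} d p q with x ≟ y
  ... | yes e = e
  ... | no ne = contradiction (≤-trans (two-true (adj G u) p q ne) d) λ { (s≤s ()) }
  shared-edge : ∀ {u w} → u ≢ w → deg G u ≤ 1 → ∃[ x ] Shared C₁ C₂ u x
  shared-edge {u} u≢w d with first-step C₁ c₁ u≢w | first-step C₂ c₂ u≢w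
  ... | x , p | y , q = x , p , subst (λ z → adj C₂ u z ≡ true) (unique d (s₂ _ _ q) (s₁ _ _ p)) q
  conclude : ∃[ x ] Shared C₁ C₂ u x → ∃[ y ] Shared C₁ C₂ v y → ⊥
  conclude (x , p) (y , q) with sh u x v y p q
  ... | _ , inj₁ (u≡v , _) = u≢v u≡v
  ... | _ , inj₂ (refl , refl) = impossible (walk-within (λ i → i ≡ u ⊎ i ≡ v) closed (c₁ u w) (inj₁ refl))
    where
    closed : ∀ i j → adj C₁ i j ≡ true → i ≡ u ⊎ i ≡ v → j ≡ u ⊎ j ≡ v
    closed i j e (inj₁ refl) = inj₂ (unique du (s₁ _ _ e) (s₁ _ _ (proj₁ p)))
    closed i j e (inj₂ refl) = inj₁ (unique dv (s₁ _ _ e) (s₁ _ _ (proj₁ q)))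
    impossible : w ≡ u ⊎ w ≡ v → ⊥
    impossible (inj₁ e) = u≢w (≡.sym e)
    impossible (inj₂ e) = v≢w (≡.sym e)

-- Indexing and the integer form of the bound

at-suc : (d : Fin n → ℕ) → ∀ {k} (k<n : k < n) → at d (suc k) ≡ d (fromℕ< k<n)
at-suc {n} d {k} k<n with k <? n
... | yes p = cong (λ q → d (fromℕ< q)) (≤-irrelevant p k<n)
... | no ¬p = contradiction k<n ¬p

open import Data.Integer using (ℤ; +_; _-_; _*_; +≤+) renaming (_≤_ to _≤ℤ_)
import Data.Integer as ℤ
import Data.Integer.Properties as ℤ

cancel-2 : ∀ i → (i - + 2) ℤ.+ + 2 ≡ i
cancel-2 i = trans (ℤ.+-assoc i (ℤ.- + 2) (+ 2)) (ℤ.+-identityʳ i)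

-- Subtraction in the integers lets the left side be negative for fewer than two vertices; with
-- `suc m` vertices the bound becomes an additive one in ℕ.
ℤ-bound : ∀ m S → (+ 4) * (+ suc m - + 1) - + 2 ≤ℤ + S → 4 · m ≤ S + 2
ℤ-bound m S p = ℤ.drop‿+≤+ (≡.subst₂ _≤ℤ_ (trans (cancel-2 ((+ 4) * + m)) (≡.sym (ℤ.pos-* 4 m))) refl (ℤ.+-monoˡ-≤ (+ 2) p))

ℤ-bound⁻¹ : ∀ m S → 4 · m ≤ S + 2 → (+ 4) * (+ suc m - + 1) - + 2 ≤ℤ + S
ℤ-bound⁻¹ m S p = ≡.subst₂ _≤ℤ_ (cong (_- + 2) (ℤ.pos-* 4 m)) (trans (ℤ.+-assoc (+ S) (+ 2) (ℤ.- + 2)) (ℤ.+-identityʳ (+ S))) (ℤ.+-monoˡ-≤ (ℤ.- + 2) (+≤+ p))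

-- Sequences of length at least 3

module Sequence (k : ℕ) (d : Fin (3 + k) → ℕ) where

  u<n : suc k < 3 + k
  u<n = s≤s (n≤1+n (suc k))
  v<n : suc (suc k) < 3 + k
  v<n = ≤-refl

  -- The last two vertices, 1-based positions `n - 1` and `n` for `n = 3 + k`; `zero` serves as a
  -- third vertex distinct from both.
  u v : Fin (3 + k)
  u = fromℕ< u<n
  v = fromℕ< v<n

  u≢v : u ≢ v
  u≢v e = contradiction (trans (≡.sym (toℕ-fromℕ< u<n)) (trans (cong toℕ e) (toℕ-fromℕ< v<n))) λ p → 1+n≢n (≡.sym p)
  u≢0 : u ≢ zero
  u≢0 e = contradiction (trans (≡.sym (toℕ-fromℕ< u<n)) (cong toℕ e)) λ ()
  v≢0 : v ≢ zero
  v≢0 e = contradiction (trans (≡.sym (toℕ-fromℕ< v<n)) (cong toℕ e)) λ ()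

  below-u : ∀ i → v ≢ i → toℕ i ≤ toℕ u
  below-u i v≢i = ≤-trans (≤-pred (≤∧≢⇒< (≤-pred (toℕ<n i)) λ e → v≢i (toℕ-injective (trans (toℕ-fromℕ< v<n) (≡.sym e))))) (≤-reflexive (≡.sym (toℕ-fromℕ< u<n)))

  u≤v : toℕ u ≤ toℕ v
  u≤v = ≤-trans (≤-reflexive (toℕ-fromℕ< u<n)) (≤-trans (n≤1+n (suc k)) (≤-reflexive (≡.sym (toℕ-fromℕ< v<n))))

  sufficient : NonIncreasing d → (G : SimpleGraph (3 + k)) → (∀ i → deg G i ≡ d i) → 4 · (2 + k) ≤ total G + 2 → 2 ≤ d u → 1 ≤ d v → Packs true d
  -- By monotonicity every vertex other than `v` has degree at least 2, so `v` is the only possible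
  -- leaf.
  sufficient mono G r big 2≤du 1≤dv = packs-cong r (by-last (2 ≤? deg G v))
    where
    low : ∀ i → v ≢ i → 2 ≤ deg G i
    low i v≢i = ≤-trans 2≤du (≤-trans (mono i u (below-u i v≢i)) (≤-reflexive (≡.sym (r i))))
    by-last : Dec (2 ≤ deg G v) → Packs true (deg G)
    by-last (yes 2≤dv) = packing (2 + k) true G all-low big
      where
      all-low : ∀ i → 2 ≤ deg G i
      all-low i with v ≟ i
      ... | yes refl = 2≤dv
      ... | no v≢i   = low i v≢i
    by-last (no dv<2) = packing-leaf (s≤s z≤n) G v (≤-antisym (≤-pred (≰⇒> dv<2)) (≤-trans 1≤dv (≤-reflexive (≡.sym (r v))))) low big

  necessary : NonIncreasing d → {G C₁ C₂ : SimpleGraph (3 + k)} → (∀ i → deg G i ≡ d i) → Subgraph C₁ G → Subgraph C₂ G →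
    Connected C₁ → Connected C₂ → Share true C₁ C₂ → 2 ≤ d u × 1 ≤ d v
  necessary mono {G} {C₁} {C₂} r s₁ s₂ c₁ c₂ sh = ≰⇒> two-leaves , ≤-trans positive (≤-reflexive (r v))
    where
    two-leaves : ¬ (d u ≤ 1)
    -- By monotonicity `v` would then be a leaf as well.
    two-leaves du≤1 = one-leaf {C₁ = C₁} {C₂} {G} s₁ s₂ c₁ c₂ sh u≢v u≢0 v≢0
      (≤-trans (≤-reflexive (r u)) du≤1) (≤-trans (≤-reflexive (r v)) (≤-trans (mono u v u≤v) du≤1))
    positive : 1 ≤ deg G v
    positive with first-step C₁ c₁ v≢0
    ... | x , e = ≤-trans (≤-reflexive (cong ι (≡.sym (s₁ v x e)))) (sum-≥ (ι ∘ adj G v) x)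

-- Short sequences and the equivalence

edge-on-two : (G : SimpleGraph 2) → 4 ≤ total G + 2 → adj G zero (suc zero) ≡ true
edge-on-two G big with adj G zero (suc zero) in e
... | true  = refl
... | false rewrite irrfl G zero | irrfl G (suc zero) | adj-sym G e = contradiction big λ { (s≤s (s≤s ())) }

packs-small : (G : SimpleGraph n) → n ≤ 2 → (+ 4) * (+ n - + 1) - + 2 ≤ℤ + total G → Packs true (deg G)
packs-small {0} G _ _ = G , (λ _ → refl) , G , G , (λ _ _ p → p) , (λ _ _ p → p) , (λ ()) , (λ ()) , λ ()
packs-small {1} G _ _ = G , (λ _ → refl) , G , G , (λ _ _ p → p) , (λ _ _ p → p) , conn , conn , λ { zero zero _ _ (p , _) _ → ⊥-elim (true≢false p (irrfl G zero)) }
  where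
  conn : Connected G
  conn zero zero = here
-- On two vertices the bound requires degree sum at least 2, which forces the edge.
packs-small {2} G _ big = packs-K₂ G (edge-on-two G (ℤ-bound 1 (total G) big))
packs-small {suc (suc (suc _))} G (s≤s (s≤s ())) _

theorem3p1 : (n : ℕ) (d : Fin n → ℕ) → Graphical d →
    (∃[ G ] (Realizes G d × ∃[ T₁ ] ∃[ T₂ ]
    (IsSpanningTree T₁ G × IsSpanningTree T₂ G × ShareAtMostOneEdge T₁ T₂)))
    ⇔ (((+ 4) * (+ n - + 1) - + 2 ≤ℤ + sumSeq d)
    × (n ≤ 2 ⊎ (2 < n × 2 ≤ at d (n Data.Nat.∸ 1) × 1 ≤ at d n)))
theorem3p1 n d (mono , G₀ , real₀) = mk⇔ (only-if n d mono) (if n d mono G₀ (λ i → trans (≡.sym (degree≡deg G₀ i)) (real₀ i)))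
  where
  Condition : (n : ℕ) → (Fin n → ℕ) → Set
  Condition n d = ((+ 4) * (+ n - + 1) - + 2 ≤ℤ + sumSeq d) × (n ≤ 2 ⊎ (2 < n × 2 ≤ at d (n Data.Nat.∸ 1) × 1 ≤ at d n))

  total≡sumSeq : ∀ {n} (d : Fin n → ℕ) (G : SimpleGraph n) → (∀ i → deg G i ≡ d i) → total G ≡ sumSeq d
  total≡sumSeq d G r = trans (sum-cong-≗ r) (≡.sym (listSum≡sum d))

  if : ∀ n d → NonIncreasing d → (G : SimpleGraph n) → (∀ i → deg G i ≡ d i) → Condition n d → ∃[ G ] (Realizes G d × SpanningPair G)
  if n d mono G r (big , inj₁ n≤2) = packs⇒pair (packs-cong r (packs-small G n≤2 (subst (λ S → (+ 4) * (+ n - + 1) - + 2 ≤ℤ + S) (≡.sym (total≡sumSeq d G r)) big)))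
  if (suc (suc (suc k))) d mono G r (big , inj₂ (_ , 2≤ , 1≤)) = packs⇒pair (sufficient mono G r
    (≤-trans (ℤ-bound (2 + k) (sumSeq d) big) (≤-reflexive (cong (_+ 2) (≡.sym (total≡sumSeq d G r)))))
    (≤-trans 2≤ (≤-reflexive (at-suc d u<n))) (≤-trans 1≤ (≤-reflexive (at-suc d v<n))))
    where open Sequence k d
  if (suc (suc zero)) d mono G r (_ , inj₂ (s≤s (s≤s ()) , _))
  if (suc zero) d mono G r (_ , inj₂ (s≤s () , _))
  if zero d mono G r (_ , inj₂ (() , _))

  only-if : ∀ n d → NonIncreasing d → ∃[ G ] (Realizes G d × SpanningPair G) → Condition n d
  -- For `n = 0` the left side of the bound is -6.
  only-if zero    d mono _ = ℤ.-≤+ , inj₁ z≤n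
  only-if (suc m) d mono (G , real , T₁ , T₂ , (s₁ , c₁ , _) , (s₂ , c₂ , _) , sh) =
    ℤ-bound⁻¹ m (sumSeq d) (≤-trans (pair-total {C₁ = T₁} {T₂} {G} s₁ s₂ c₁ c₂ sh′) (≤-reflexive (cong (_+ 2) (total≡sumSeq d G r)))) ,
    minimum m d mono G r T₁ T₂ s₁ s₂ c₁ c₂ sh′
    where
    r : ∀ i → deg G i ≡ d i
    r i = trans (≡.sym (degree≡deg G i)) (real i)
    sh′ : Share true T₁ T₂
    sh′ = symmetric-share {T₁ = T₁} {T₂} sh
    minimum : ∀ m (d : Fin (suc m) → ℕ) → NonIncreasing d → (G : SimpleGraph (suc m)) → (∀ i → deg G i ≡ d i) →
      (T₁ T₂ : SimpleGraph (suc m)) → Subgraph T₁ G → Subgraph T₂ G → Connected T₁ → Connected T₂ → Share true T₁ T₂ →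
      suc m ≤ 2 ⊎ (2 < suc m × 2 ≤ at d m × 1 ≤ at d (suc m))
    minimum 0 d mono G r T₁ T₂ s₁ s₂ c₁ c₂ sh = inj₁ (s≤s z≤n)
    minimum 1 d mono G r T₁ T₂ s₁ s₂ c₁ c₂ sh = inj₁ ≤-refl
    minimum (suc (suc k)) d mono G r T₁ T₂ s₁ s₂ c₁ c₂ sh with Sequence.necessary k d mono {G} {T₁} {T₂} r s₁ s₂ c₁ c₂ sh
    ... | 2≤ , 1≤ = inj₂ (s≤s (s≤s (s≤s z≤n)) , ≤-trans 2≤ (≤-reflexive (≡.sym (at-suc d (Sequence.u<n k d)))) , ≤-trans 1≤ (≤-reflexive (≡.sym (at-suc d (Sequence.v<n k d)))))
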